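{- For every integer $\ell\ge 6$, we have $R(F_\ell,K_6)=10\ell+1$.
   Context: All graphs are finite and simple. For two graphs $F,H$, $R(F,H)$ denotes the smallest positive integer $r$ such that for every graph $G$ of order $r$, either $G$ contains $F$ as a subgraph (not necessarily induced) or the complement $\overline{G}$ contains $H$ as a subgraph. $K_n$ is the complete graph on $n$ vertices, and $\ell K_2$ is the disjoint union of $\ell$ copies of $K_2$. The fan graph $F_\ell$ is the join of $K_1$ and $\ell K_2$, i.e. $\ell$ triangles sharing exactly one common vertex (so $F_\ell$ has $2\ell+1$ vertices). -}

module Defs where

open import Data.Fin using (Fin)
import Data.Fin.Properties as Fin
open import Data.Nat using (ℕ; _≤_; _<_)
open import Data.Product using (Σ-syntax; _×_; _,_)
open import Data.Sum using (_⊎_; inj₁; inj₂)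
open import Data.Unit using (⊤; tt)
open import Function.Definitions using (Injective)
open import Level using (0ℓ)
open import Relation.Binary.Core using (Rel)
open import Relation.Binary.Definitions
  using (Symmetric; Irreflexive; Decidable; DecidableEquality)
open import Relation.Binary.PropositionalEquality using (_≡_; _≢_; refl; sym)
open import Relation.Nullary using (¬_; yes)
open import Relation.Nullary.Decidable using (¬?; _×-dec_)

-- Adjacency is required to be decidable, as it is classically; this is what
-- makes "G contains F or the complement of G contains H" meaningful
-- constructively.  A graph of order n is a Graph (Fin n).
record Graph (V : Set) : Set₁ where
  field
    Adj     : Rel V 0ℓ
    symm    : Symmetric Adj
    irrefl  : Irreflexive _≡_ Adj
    adj?    : Decidable Adj

open Graph public

complement : ∀ {V} → DecidableEquality V → Graph V → Graph V
complement _≟_ G = record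
  { Adj    = λ u v → u ≢ v × ¬ Adj G u v
  ; symm   = λ (u≢v , ¬uv) → (λ v≡u → u≢v (sym v≡u)) , (λ vu → ¬uv (symm G vu))
  ; irrefl = λ u≡v (u≢v , _) → u≢v u≡v
  ; adj?   = λ u v → ¬? (u ≟ v) ×-dec ¬? (adj? G u v)
  }

complete : ∀ n → Graph (Fin n)
complete n = record
  { Adj    = _≢_
  ; symm   = λ u≢v v≡u → u≢v (sym v≡u)
  ; irrefl = λ u≡v u≢v → u≢v u≡v
  ; adj?   = λ u v → ¬? (u Fin.≟ v)
  }

-- The disjoint union of ℓ copies of G; the first component names the copy.
copies : ∀ {V} (ℓ : ℕ) → Graph V → Graph (Fin ℓ × V)
copies ℓ G = record
  { Adj    = λ (i , u) (j , v) → i ≡ j × Adj G u v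
  ; symm   = λ (i≡j , uv) → sym i≡j , symm G uv
  ; irrefl = λ { refl (_ , uu) → irrefl G refl uu }
  ; adj?   = λ (i , u) (j , v) → (i Fin.≟ j) ×-dec adj? G u v
  }

module _ {V W : Set} (G : Graph V) (H : Graph W) where

  JoinAdj : Rel (V ⊎ W) 0ℓ
  JoinAdj (inj₁ u) (inj₁ v) = Adj G u v
  JoinAdj (inj₂ u) (inj₂ v) = Adj H u v
  JoinAdj (inj₁ _) (inj₂ _) = ⊤
  JoinAdj (inj₂ _) (inj₁ _) = ⊤

  private
    join-sym : Symmetric JoinAdj
    join-sym {inj₁ _} {inj₁ _} uv = symm G uv
    join-sym {inj₂ _} {inj₂ _} uv = symm H uv
    join-sym {inj₁ _} {inj₂ _} _  = tt
    join-sym {inj₂ _} {inj₁ _} _  = tt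

    join-irrefl : Irreflexive _≡_ JoinAdj
    join-irrefl {inj₁ _} refl uu = irrefl G refl uu
    join-irrefl {inj₂ _} refl uu = irrefl H refl uu

    join-adj? : Decidable JoinAdj
    join-adj? (inj₁ u) (inj₁ v) = adj? G u v
    join-adj? (inj₂ u) (inj₂ v) = adj? H u v
    join-adj? (inj₁ _) (inj₂ _) = yes tt
    join-adj? (inj₂ _) (inj₁ _) = yes tt

  join : Graph (V ⊎ W)
  join = record
    { Adj    = JoinAdj
    ; symm   = λ {u} {v} → join-sym {u} {v}
    ; irrefl = λ {u} {v} → join-irrefl {u} {v}
    ; adj?   = join-adj?
    }

fan : (ℓ : ℕ) → Graph (Fin 1 ⊎ (Fin ℓ × Fin 2))
fan ℓ = join (complete 1) (copies ℓ (complete 2))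

-- G contains F as a (not necessarily induced) subgraph.
_Contains_ : ∀ {V W} → Graph W → Graph V → Set
_Contains_ {V} {W} G F =
  Σ[ f ∈ (V → W) ] Injective _≡_ _≡_ f × (∀ u v → Adj F u v → Adj G (f u) (f v))

Arrows : ∀ {V W} → ℕ → Graph V → Graph W → Set₁
Arrows r F H =
  (G : Graph (Fin r)) → G Contains F ⊎ complement Fin._≟_ G Contains H

-- R(F,H) = r.  The Ramsey number is given by its defining property, so that
-- its existence is part of the assertion.
IsRamseyNumber : ∀ {V W} → Graph V → Graph W → ℕ → Set₁
IsRamseyNumber F H r =
  0 < r × Arrows r F H × (∀ s → 0 < s → Arrows s F H → r ≤ s)

{-# OPTIONS --safe #-}
-- Lower bound: the residue classes modulo 5 are five disjoint cliques of order 2ℓ.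
--
-- Upper bound.  If no neighbourhood contains ℓ disjoint edges and α(S) ≤ k, a
-- greedy matching bounds all degrees in S by 2ℓ − 2 + k, and at a vertex x
-- attaining this bound adjacency is transitive on the neighbourhood, so a vertex
-- outside a maximal clique through x has no neighbour in it except possibly x.
-- By induction on k, |S| ≤ 2ℓk for k ≤ 5: deleting any set Y with
-- |S ∖ Y| > 2ℓ(k − 1) leaves an independent k-set, which must dominate Y.
-- Taking for Y a clique of order 2ℓ − 1 and possibly one further vertex shows
-- that there is no such clique.  Without such cliques, |S| is at most 2ℓ − 2,
-- 4ℓ − 4, 6ℓ − 3, 8ℓ − 2, 10ℓ for k = 1, …, 5.  Indeed, in each step the bounds for
-- smaller k force large degrees and small codegrees of nonadjacent vertices, so
-- that a vertex outside a large maximal clique has few neighbours in it and k of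
-- them cannot dominate it; and if all cliques are small, an independent k-set I
-- bounds |S|, because the vertices with exactly one neighbour in I fall into k
-- cliques and all others are covered twice by the closed neighbourhoods.

module Submission where

open import Data.Empty using (⊥; ⊥-elim)
open import Data.Fin as Fin using (Fin; zero; suc; toℕ)
import Data.Fin.Properties as Fin
open import Data.List using (List; []; _∷_; length; take; lookup)
open import Data.Nat
open import Data.Nat.DivMod
open import Data.Nat.Properties
open import Data.Nat.Tactic.RingSolver using (solve)
open import Data.Product using (Σ; ∃-syntax; _×_; _,_; proj₁; proj₂)
open import Data.Sum using (_⊎_; inj₁; inj₂; [_,_]′)
open import Data.Unit using (⊤; tt)
open import Function using (_∘_; id; case_of_)
open import Relation.Binary.PropositionalEquality hiding ([_])
open import Relation.Nullary
open import Relation.Nullary.Decidable using (¬?; _×-dec_; _⊎-dec_; _→-dec_; map′; decidable-stable)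
open import Algebra.Properties.CommutativeMonoid.Sum +-0-commutativeMonoid using (sum; sum-cong-≗; ∑-distrib-+)
open import Defs

-- Linear inequalities reduced to semiring identities.

infixr 5 _⊕_
infixr 6 _⊗_

_⊕_ : ∀ {a b c d} → a ≤ b → c ≤ d → a + c ≤ b + d
_⊕_ = +-mono-≤

_⊗_ : ∀ {a b} k → a ≤ b → k * a ≤ k * b
k ⊗ a≤b = *-monoʳ-≤ k a≤b

-- `contra` and `infer` take a certificate of linear arithmetic: `a ≤ b` is a sum of multiples of
-- the hypotheses, `r` is the remaining slack, and only a semiring identity is left to the solver.
contra : ∀ {a b} → a ≤ b → ∀ r → a ≡ suc (b + r) → ⊥
contra {b = b} a≤b r refl = <-irrefl refl (≤-trans (s≤s (m≤m+n b r)) a≤b)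

infer : ∀ {a b x y} → a ≤ b → ∀ r → x + b + r ≡ y + a → x ≤ y
infer {a} {b} {x} {y} a≤b r eq = +-cancelʳ-≤ b x y (begin
  x + b      ≤⟨ m≤m+n (x + b) r ⟩
  x + b + r  ≡⟨ eq ⟩
  y + a      ≤⟨ +-monoʳ-≤ y a≤b ⟩
  y + b      ∎)
  where open ≤-Reasoning

abstract

  greedy-edge : ∀ m k p → 2 * suc m + k ≤ suc p → k < p
  greedy-edge m k p h = infer h (2 * m) (solve (m ∷ k ∷ p ∷ []))

  greedy-step : ∀ m k p p′ → 2 * suc m + k ≤ suc p → p ≤ 2 + p′ → 2 * m + k ≤ suc p′
  greedy-step m k p p′ h h′ = infer (h ⊕ h′) 0 (solve (m ∷ k ∷ p ∷ p′ ∷ []))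

  path-edge₂ : ∀ k p p′ → 4 + k ≤ p + 2 → p ≤ suc p′ → k < p′
  path-edge₂ k p p′ h h′ = infer (h ⊕ h′) 0 (solve (k ∷ p ∷ p′ ∷ []))

  path-edge : ∀ m k p q r → 2 * (3 + m) + k ≤ p + 2 → p ≤ 2 + q → q ≤ suc r → k < r
  path-edge m k p q r h h′ h″ = infer (h ⊕ h′ ⊕ h″) (2 * m) (solve (m ∷ k ∷ p ∷ q ∷ r ∷ []))

  path-step : ∀ m k p q → 2 * (3 + m) + k ≤ p + 2 → p ≤ 2 + q → 2 * (2 + m) + k ≤ q + 2
  path-step m k p q h h′ = infer (h ⊕ h′) 0 (solve (m ∷ k ∷ p ∷ q ∷ []))

  cover-step : ∀ s t a b M → a ≤ M → b ≤ s + M * t → a + b ≤ s + M * suc t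
  cover-step s t a b M h h′ = infer (h ⊕ h′) 0 (solve (s ∷ t ∷ a ∷ b ∷ M ∷ []))

  codegree-sum : ∀ s d e p q r u w → s ≤ suc d + p → p ≡ q + r → q ≤ suc u → e ≡ w + u →
                 ∀ {w′} → w′ ≤ w → s + w′ ≤ suc d + suc e + r
  codegree-sum s d _ _ q r u w h₁ refl h₃ refl {w′} h₅ =
    infer (h₁ ⊕ h₃ ⊕ h₅) 0 (solve (s ∷ d ∷ q ∷ r ∷ u ∷ w ∷ w′ ∷ []))

  deg-step : ∀ m k d → suc (2 * m + 10 + k) ≤ d → 2 * (6 + m) + k ≤ suc d
  deg-step m k d h = infer h 0 (solve (m ∷ k ∷ d ∷ []))

  top-step : ∀ m k d → 2 * m + 10 + k ≤ d → 2 * (6 + m) + k ≤ d + 2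
  top-step m k d h = infer h 0 (solve (m ∷ k ∷ d ∷ []))

  codegree-top : ∀ m k B s c a d e r → 2 * (2 * m + 12 + k) + 2 + B ≤ s + c → s + a ≤ suc d + suc e + r →
                 c ≤ a → d ≤ 2 * m + 10 + (2 + k) → r ≤ B → 2 * m + 10 + (2 + k) ≤ e
  codegree-top m k B s c a d e r h₁ h₂ h₃ h₄ h₅ =
    infer (h₁ ⊕ h₂ ⊕ h₃ ⊕ h₄ ⊕ h₅) 0 (solve (m ∷ k ∷ B ∷ s ∷ c ∷ a ∷ d ∷ e ∷ r ∷ []))

  codegree-bound : ∀ m k B s c a d e r → 2 * (2 * m + 12 + k) + 2 + B ≤ s + c → s + a ≤ suc d + suc e + r →
                   d ≤ 2 * m + 10 + (2 + k) → e ≤ 2 * m + 10 + (2 + k) → r ≤ B → a ≤ c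
  codegree-bound m k B s c a d e r h₁ h₂ h₃ h₄ h₅ =
    infer (h₁ ⊕ h₂ ⊕ h₃ ⊕ h₄ ⊕ h₅) 0 (solve (m ∷ k ∷ B ∷ s ∷ c ∷ a ∷ d ∷ e ∷ r ∷ []))

  outside-count₀ : ∀ k c q s → suc k + suc c ≤ q → s ≡ suc k → q ≤ s → ⊥
  outside-count₀ k c q s h₁ h₂ h₃ = contra (h₁ ⊕ h₃ ⊕ ≤-reflexive h₂) c (solve (k ∷ c ∷ q ∷ s ∷ []))

  outside-count₁ : ∀ k c q a x s t → suc k + suc c ≤ q → q ≡ a + x → a ≤ suc c → s + suc t ≡ suc k → x ≤ s → ⊥
  outside-count₁ k c q a x s t h₁ h₂ h₃ h₄ h₅ =
    contra (h₁ ⊕ ≤-reflexive h₂ ⊕ h₃ ⊕ ≤-reflexive h₄ ⊕ h₅) t (solve (k ∷ c ∷ q ∷ a ∷ x ∷ s ∷ t ∷ []))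

  top-count : ∀ k q s t → s + t ≡ k → q ≤ s → q ≤ k
  top-count k q s t refl h = ≤-trans h (m≤m+n s t)

  degree-≥ : ∀ b s d r B → suc b + B ≤ s → s ≤ suc d + r → r ≤ B → b ≤ d
  degree-≥ b s d r B h₁ h₂ h₃ = infer (h₁ ⊕ h₂ ⊕ h₃) 0 (solve (b ∷ s ∷ d ∷ r ∷ B ∷ []))

  rest-> : ∀ B y s r y′ → suc B + y ≤ s → s ≤ y′ + r → y′ ≤ y → B < r
  rest-> B y s r y′ h₁ h₂ h₃ = infer (h₁ ⊕ h₂ ⊕ h₃) 0 (solve (B ∷ y ∷ s ∷ r ∷ y′ ∷ []))

  clique-match : ∀ m c q r → 2 * m + (2 * c) + r ≤ q → ∀ p → q ≤ r + p → 2 * (c + m) + 1 ≤ suc p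
  clique-match m c q r h p h′ = infer (h ⊕ h′) 0 (solve (m ∷ c ∷ q ∷ r ∷ p ∷ []))

  exclusion-size : ∀ m k s y → y ≤ 2 * m + 12 → suc ((2 * m + 12) * suc k) ≤ s → suc ((2 * m + 12) * k) + y ≤ s
  exclusion-size m k s y h h′ = infer (h ⊕ h′) 0 (solve (m ∷ k ∷ s ∷ y ∷ []))

  exclusion-2 : ∀ m q k s t → suc k ≤ 5 → 2 * m + 11 ≤ q → s + t ≡ suc k → q ≤ s + 2 * t → ⊥
  exclusion-2 m q k s t h₁ h₂ st h₃ = contra (h₂ ⊕ h₃ ⊕ 2 ⊗ h₁ ⊕ 2 ⊗ ≤-reflexive st) (2 * m + s)
    (solve (m ∷ q ∷ k ∷ s ∷ t ∷ []))

  exclusion-3 : ∀ m q k s t → suc k ≤ 5 → 2 * m + 11 ≤ q → s + t ≡ suc k → 3 ≤ s → q ≤ s + 3 * t → ⊥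
  exclusion-3 m q k s t h₁ h₂ st h₄ h₃ = contra (h₂ ⊕ h₃ ⊕ 3 ⊗ h₁ ⊕ 3 ⊗ ≤-reflexive st ⊕ 2 ⊗ h₄) (2 * m + 1)
    (solve (m ∷ q ∷ k ∷ s ∷ t ∷ []))

  exclusion-4 : ∀ m q k s t → suc k ≤ 5 → 2 * m + 11 ≤ q → s + t ≡ suc k → 4 ≤ s → q ≤ s + 4 * t → ⊥
  exclusion-4 m q k s t h₁ h₂ st h₄ h₃ = contra (h₂ ⊕ h₃ ⊕ 4 ⊗ h₁ ⊕ 4 ⊗ ≤-reflexive st ⊕ 3 ⊗ h₄) (2 * m + 2)
    (solve (m ∷ q ∷ k ∷ s ∷ t ∷ []))

  exclusion-5 : ∀ m q k s t → suc k ≤ 5 → 2 * m + 11 ≤ q → s + t ≡ suc k → 5 ≤ s → q ≤ s + 5 * t → ⊥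
  exclusion-5 m q k s t h₁ h₂ st h₄ h₃ = contra (h₂ ⊕ h₃ ⊕ 5 ⊗ h₁ ⊕ 5 ⊗ ≤-reflexive st ⊕ 4 ⊗ h₄) (2 * m + 5)
    (solve (m ∷ q ∷ k ∷ s ∷ t ∷ []))

  exclusion-6 : ∀ M k s t → suc k ≤ 5 → s + t ≡ suc k → 6 + M + 2 ≤ suc (suc s) → ⊥
  exclusion-6 M k s t h₁ st h₂ = contra (h₁ ⊕ ≤-reflexive st ⊕ h₂) (M + t) (solve (M ∷ k ∷ s ∷ t ∷ []))

  outside-≥5 : ∀ m d q q′ a r → 2 * m + 14 ≤ d → d ≡ a + r → a ≤ q′ → suc q′ ≤ q → q ≤ 2 * m + 10 → 5 ≤ r
  outside-≥5 m d q q′ a r h₁ refl h₂ h₃ h₄ = infer (h₁ ⊕ h₂ ⊕ h₃ ⊕ h₄) 0 (solve (m ∷ q ∷ q′ ∷ a ∷ r ∷ []))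

  outside-≥7 : ∀ m d q q′ a r → 2 * m + 15 ≤ d → d ≡ a + r → a ≤ q′ → suc q′ ≤ q → q ≤ 2 * m + 9 → 7 ≤ r
  outside-≥7 m d q q′ a r h₁ refl h₂ h₃ h₄ = infer (h₁ ⊕ h₂ ⊕ h₃ ⊕ h₄) 0 (solve (m ∷ q ∷ q′ ∷ a ∷ r ∷ []))

  two-more : ∀ m q a r b r′ → 2 * m + 10 ≤ q → q ≡ a + r → a ≤ 3 → r ≡ b + r′ → b ≤ 3 → 1 ≤ r′
  two-more m q a r b r′ h₁ refl h₂ refl h₃ = infer (h₁ ⊕ h₂ ⊕ h₃) (2 * m + 3) (solve (m ∷ a ∷ b ∷ r′ ∷ []))

  one-more : ∀ m q r → 2 * m + 10 ≤ q → q ≤ suc r → 1 ≤ r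
  one-more m q r h h′ = infer (h ⊕ h′) (2 * m + 8) (solve (m ∷ q ∷ r ∷ []))

  one-more₉ : ∀ m q r → 2 * m + 9 ≤ q → q ≤ suc r → 1 ≤ r
  one-more₉ m q r h h′ = infer (h ⊕ h′) (2 * m + 7) (solve (m ∷ q ∷ r ∷ []))

  single-leaf : ∀ m q s t → 2 * m + 10 ≤ q → s + t ≡ 5 → 1 ≤ s → q ≤ s + 2 * t → ⊥
  single-leaf m q s t h₁ st h₂ h₃ = contra (h₁ ⊕ 2 ⊗ ≤-reflexive st ⊕ h₂ ⊕ h₃) (2 * m) (solve (m ∷ q ∷ s ∷ t ∷ []))

  three-leaves : ∀ m q s t → 2 * m + 10 ≤ q → s + t ≡ 5 → 3 ≤ s → q ≤ s + 3 * t → ⊥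
  three-leaves m q s t h₁ st h₂ h₃ = contra (h₁ ⊕ 3 ⊗ ≤-reflexive st ⊕ 2 ⊗ h₂ ⊕ h₃) (2 * m) (solve (m ∷ q ∷ s ∷ t ∷ []))

  five-rest : ∀ m s q e → 10 * m + 61 ≤ s → q ≤ 2 * m + 10 → e ≤ 4 → suc (8 * m + 46) + (q + e) ≤ s
  five-rest m s q e h₁ h₂ h₃ = infer (h₁ ⊕ h₂ ⊕ h₃) 0 (solve (m ∷ s ∷ q ∷ e ∷ []))

  five-degree : ∀ m → suc (2 * m + 14) + (8 * m + 46) ≡ 10 * m + 61
  five-degree m = solve (m ∷ [])

  two-rest : ∀ m s → 4 * m + 20 < s → suc (2 * m + 10) + (2 * m + 10) ≤ s
  two-rest m s h = infer h 0 (solve (m ∷ s ∷ []))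

  two-codegree : ∀ m s → 4 * m + 20 < s → 2 * (2 * m + 12 + 0) + 2 + 0 ≤ s + 5
  two-codegree m s h = infer h 0 (solve (m ∷ s ∷ []))

  two-count : ∀ m q s t → 2 * m + 8 < q → s + t ≡ 2 → q ≤ s + 4 * t → ⊥
  two-count m q s t h₁ h₂ h₃ = contra (h₁ ⊕ 4 ⊗ ≤-reflexive h₂ ⊕ h₃) (2 * m + 3 * s) (solve (m ∷ q ∷ s ∷ t ∷ []))

  two-degree : ∀ m s d r → 4 * m + 20 < s → s ≤ suc d + r → r ≤ 2 * m + 8 → 2 * m + 10 + 2 ≤ d
  two-degree m s d r h₁ h₂ h₃ = infer (h₁ ⊕ h₂ ⊕ h₃) 0 (solve (m ∷ s ∷ d ∷ r ∷ []))

  two-clique : ∀ m s d r q → 4 * m + 20 < s → s ≤ suc d + r → d ≤ 2 * m + 10 + 2 → r ≤ q → q ≤ 2 → ⊥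
  two-clique m s d r q h₁ h₂ h₃ h₄ h₅ = contra (h₁ ⊕ h₂ ⊕ h₃ ⊕ h₄ ⊕ h₅) (2 * m + 5) (solve (m ∷ s ∷ d ∷ r ∷ q ∷ []))

  three-degree : ∀ m s → 6 * m + 33 < s → suc (2 * m + 10 + 3) + (4 * m + 20) ≤ s
  three-degree m s h = infer h 0 (solve (m ∷ s ∷ []))

  three-rest : ∀ m s → 6 * m + 33 < s → suc (4 * m + 20) + (2 * m + 10) ≤ s
  three-rest m s h = infer h 3 (solve (m ∷ s ∷ []))

  three-whole : ∀ m s → 6 * m + 33 < s → 4 * m + 20 < s
  three-whole m s h = infer h (2 * m + 13) (solve (m ∷ s ∷ []))

  three-bound : ∀ m c d → c ≤ 3 → d ≤ 2 * m + 10 + 3 → c + suc d ≤ 2 * m + 17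
  three-bound m c d h₁ h₂ = infer (h₁ ⊕ h₂) 0 (solve (m ∷ c ∷ d ∷ []))

  three-private : ∀ m s → 6 * m + 33 < s → 3 * (2 * m + 17) < 2 * s
  three-private m s h = infer (2 ⊗ h) (6 * m + 16) (solve (m ∷ s ∷ []))

  four-rest : ∀ m s → 8 * m + 46 < s → suc (6 * m + 33) + (2 * m + 10) ≤ s
  four-rest m s h = infer h 3 (solve (m ∷ s ∷ []))

  four-whole : ∀ m s → 8 * m + 46 < s → 6 * m + 33 < s
  four-whole m s h = infer h (2 * m + 13) (solve (m ∷ s ∷ []))

  four-codegree : ∀ m s → 8 * m + 46 < s → 2 * (2 * m + 12 + 2) + 2 + (4 * m + 20) ≤ s + 3
  four-codegree m s h = infer h 0 (solve (m ∷ s ∷ []))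

  four-count : ∀ m q s t → 2 * m + 8 < q → s + t ≡ 4 → q ≤ s + 2 * t → ⊥
  four-count m q s t h₁ h₂ h₃ = contra (h₁ ⊕ 2 ⊗ ≤-reflexive h₂ ⊕ h₃) (2 * m + s) (solve (m ∷ q ∷ s ∷ t ∷ []))

  four-bound : ∀ m c d → c ≤ 2 * m + 8 → d ≤ 2 * m + 10 + 4 → c + suc d ≤ 4 * m + 23
  four-bound m c d h₁ h₂ = infer (h₁ ⊕ h₂) 0 (solve (m ∷ c ∷ d ∷ []))

  four-private : ∀ m s → 8 * m + 46 < s → 4 * (4 * m + 23) < 2 * s
  four-private m s h = infer (2 ⊗ h) 1 (solve (m ∷ s ∷ []))

  five-rest₀ : ∀ m s → 10 * m + 60 < s → suc (8 * m + 46) + (2 * m + 10) ≤ s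
  five-rest₀ m s h = infer h 4 (solve (m ∷ s ∷ []))

  five-whole : ∀ m s → 10 * m + 60 < s → 8 * m + 46 < s
  five-whole m s h = infer h (2 * m + 14) (solve (m ∷ s ∷ []))

  five-codegree : ∀ m s → 10 * m + 60 < s → 2 * (2 * m + 12 + 3) + 2 + (6 * m + 33) ≤ s + 4
  five-codegree m s h = infer h 0 (solve (m ∷ s ∷ []))

  five-large : ∀ m s → 10 * m + 60 < s → 10 * m + 61 ≤ s
  five-large m s h = infer h 0 (solve (m ∷ s ∷ []))

  five-bound-small : ∀ m c d → c ≤ 2 * m + 8 → d ≤ 2 * m + 10 + 5 → c + suc d ≤ 4 * m + 24
  five-bound-small m c d h₁ h₂ = infer (h₁ ⊕ h₂) 0 (solve (m ∷ c ∷ d ∷ []))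

  five-bound-low : ∀ m c d → c ≤ 2 * m + 9 → d < 2 * m + 10 + 5 → c + suc d ≤ 4 * m + 24
  five-bound-low m c d h₁ h₂ = infer (h₁ ⊕ h₂) 0 (solve (m ∷ c ∷ d ∷ []))

  five-private : ∀ m s → 10 * m + 60 < s → 5 * (4 * m + 24) < 2 * s
  five-private m s h = infer (2 ⊗ h) 1 (solve (m ∷ s ∷ []))

  above : ∀ a m c q → 2 * m + a < c → c ≤ q → 2 * m + suc a ≤ q
  above a m c q h h′ = infer (h ⊕ h′) 0 (solve (a ∷ m ∷ c ∷ q ∷ []))

  seven≤ : ∀ m q → 2 * m + 8 < q → 7 ≤ q
  seven≤ m q h = infer h (2 * m + 2) (solve (m ∷ q ∷ []))

  nine≤ : ∀ m q → 2 * m + 9 < q → 9 ≤ q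
  nine≤ m q h = infer h (2 * m + 1) (solve (m ∷ q ∷ []))

  upper₁ : ∀ m s → (2 * m + 12) * 1 < s → s ≤ 2 * m + 10 → ⊥
  upper₁ m s h h′ = contra (h ⊕ h′) 2 (solve (m ∷ s ∷ []))

  upper₂ : ∀ m s → (2 * m + 12) * 2 < s → s ≤ 4 * m + 20 → ⊥
  upper₂ m s h h′ = contra (h ⊕ h′) 4 (solve (m ∷ s ∷ []))

  upper₃ : ∀ m s → (2 * m + 12) * 3 < s → s ≤ 6 * m + 33 → ⊥
  upper₃ m s h h′ = contra (h ⊕ h′) 3 (solve (m ∷ s ∷ []))

  upper₄ : ∀ m s → (2 * m + 12) * 4 < s → s ≤ 8 * m + 46 → ⊥
  upper₄ m s h h′ = contra (h ⊕ h′) 2 (solve (m ∷ s ∷ []))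

  upper₅ : ∀ m s → (2 * m + 12) * 5 < s → s ≤ 10 * m + 60 → ⊥
  upper₅ m s h h′ = contra (h ⊕ h′) 0 (solve (m ∷ s ∷ []))

  order-large : ∀ m → (2 * m + 12) * 5 < 10 * (6 + m) + 1
  order-large m = ≤-reflexive (solve (m ∷ []))

  order-small : ∀ m s → s < 10 * (6 + m) + 1 → s ≤ (6 + m) * 2 * 5
  order-small m s h = infer h 0 (solve (m ∷ s ∷ []))

-- Numerical core of `outside-degree`. If `t = 0`, at most `suc k` vertices are covered, fewer than
-- `q`; if `t > 0`, then `s ≤ k`, although `x ≥ suc k`.
outside-count : ∀ k c q a x s t → suc k + suc c ≤ q → q ≡ a + x → a ≤ suc c →
                s + t ≡ suc k → x ≤ s → q ≤ s + q * t → ⊥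
outside-count k c q a x s zero big q≡ a≤c s≡ x≤s q≤ =
  outside-count₀ k c q s big (trans (sym (+-identityʳ s)) s≡)
    (subst (q ≤_) (trans (cong (s +_) (*-zeroʳ q)) (+-identityʳ s)) q≤)
outside-count k c q a x s (suc t) big q≡ a≤c s≡ x≤s q≤ =
  outside-count₁ k c q a x s t big q≡ a≤c s≡ x≤s

open import Data.List.Membership.Propositional using (_∈_; find)
open import Data.List.Membership.Propositional.Properties using (∈-lookup)
open import Data.List.Properties using (length-take)
open import Data.List.Relation.Unary.All as All using (All; []; _∷_)
import Data.List.Relation.Unary.All.Properties as All
open import Data.List.Relation.Unary.AllPairs using (AllPairs; []; _∷_)
import Data.List.Relation.Unary.AllPairs.Properties as AllPairs
open import Data.List.Relation.Unary.Any as Any using (Any; here; there)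

-- Counting in decidable subsets of a finite set.

indicator : ∀ {A : Set} → Dec A → ℕ
indicator (yes _) = 1
indicator (no _)  = 0

sum-mono : ∀ {n} {f g : Fin n → ℕ} → (∀ x → f x ≤ g x) → sum f ≤ sum g
sum-mono {zero}  f≤g = z≤n
sum-mono {suc n} f≤g = +-mono-≤ (f≤g zero) (sum-mono (f≤g ∘ suc))

sum-positive : ∀ {n} (f : Fin n → ℕ) → 0 < sum f → ∃[ x ] 0 < f x
sum-positive {suc n} f 0<Σ with f zero in eq
... | suc _ = zero , subst (0 <_) (sym eq) (s≤s z≤n)
... | zero  with x , 0<fx ← sum-positive (f ∘ suc) 0<Σ = suc x , 0<fx

sum-zero : ∀ {n} (f : Fin n → ℕ) → (∀ x → f x ≡ 0) → sum f ≡ 0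
sum-zero {zero}  f f≡0 = refl
sum-zero {suc n} f f≡0 = cong₂ _+_ (f≡0 zero) (sum-zero (f ∘ suc) (f≡0 ∘ suc))

module Subsets (n : ℕ) where

  V : Set
  V = Fin n

  record Subset : Set₁ where
    infix 4 _∋_
    field
      _∋_  : V → Set
      mem? : ∀ x → Dec (_∋_ x)

  open Subset public

  infixr 7 _∩_
  infixl 6 _∖_ _-_

  full : Subset
  full = record { _∋_ = λ _ → ⊤ ; mem? = λ _ → yes tt }

  _∩_ : Subset → Subset → Subset
  P ∩ Q = record { _∋_ = λ x → P ∋ x × Q ∋ x ; mem? = λ x → mem? P x ×-dec mem? Q x }

  _∖_ : Subset → Subset → Subset
  P ∖ Q = record { _∋_ = λ x → P ∋ x × ¬ Q ∋ x ; mem? = λ x → mem? P x ×-dec ¬? (mem? Q x) }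

  ⟨_⟩ : V → Subset
  ⟨ a ⟩ = record { _∋_ = λ x → x ≡ a ; mem? = λ x → x Fin.≟ a }

  ⟨_⟩ˡ : List V → Subset
  ⟨ L ⟩ˡ = record { _∋_ = λ x → Any (x ≡_) L ; mem? = λ x → Any.any? (x Fin.≟_) L }

  _-_ : Subset → V → Subset
  P - a = P ∖ ⟨ a ⟩

  infix 4 _⊆_
  _⊆_ : Subset → Subset → Set
  P ⊆ Q = ∀ {x} → P ∋ x → Q ∋ x

  # : Subset → ℕ
  # P = sum (λ x → indicator (mem? P x))

  indicator-yes : ∀ {A : Set} (d : Dec A) → A → indicator d ≡ 1
  indicator-yes (yes _) _ = refl
  indicator-yes (no ¬a) a = ⊥-elim (¬a a)

  indicator-no : ∀ {A : Set} (d : Dec A) → ¬ A → indicator d ≡ 0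
  indicator-no (yes a) ¬a = ⊥-elim (¬a a)
  indicator-no (no _)  _  = refl

  indicator-mono : ∀ {A B : Set} (d : Dec A) (e : Dec B) → (A → B) → indicator d ≤ indicator e
  indicator-mono (no _)  e       f = z≤n
  indicator-mono (yes a) (yes _) f = s≤s z≤n
  indicator-mono (yes a) (no ¬b) f = ⊥-elim (¬b (f a))

  #-mono : ∀ {P Q} → P ⊆ Q → # P ≤ # Q
  #-mono {P} {Q} P⊆Q = sum-mono (λ x → indicator-mono (mem? P x) (mem? Q x) P⊆Q)

  #-split : ∀ P Q → # P ≡ # (P ∩ Q) + # (P ∖ Q)
  #-split P Q = trans (sum-cong-≗ pointwise) (∑-distrib-+ {n} _ _)
    where
    pointwise : ∀ x → indicator (mem? P x) ≡ indicator (mem? (P ∩ Q) x) + indicator (mem? (P ∖ Q) x)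
    pointwise x with mem? P x | mem? Q x
    ... | yes _ | yes _ = refl
    ... | yes _ | no _  = refl
    ... | no _  | yes _ = refl
    ... | no _  | no _  = refl

  #-positive : ∀ P → 0 < # P → ∃[ x ] P ∋ x
  #-positive P 0<P with sum-positive {n} _ 0<P
  ... | x , 0<x with mem? P x
  ...   | yes Px = x , Px

  #-empty : ∀ P → (∀ x → ¬ P ∋ x) → # P ≡ 0
  #-empty P ∅ = sum-zero {n} _ (λ x → indicator-no (mem? P x) (∅ x))

  sum-indicator-≡ : ∀ {m} (a : Fin m) (f : Fin m → ℕ) → (∀ x → x ≢ a → f x ≡ 0) → sum f ≡ f a
  sum-indicator-≡ zero    f z = trans (cong (f zero +_) (sum-zero (f ∘ suc) (λ x → z (suc x) (λ ())))) (+-identityʳ _)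
  sum-indicator-≡ (suc a) f z = trans (cong (_+ sum (f ∘ suc)) (z zero (λ ())))
    (sum-indicator-≡ a (f ∘ suc) (λ x x≢a → z (suc x) (x≢a ∘ Fin.suc-injective)))

  #-singleton : ∀ P a → P ∋ a → (∀ {x} → P ∋ x → x ≡ a) → # P ≡ 1
  #-singleton P a Pa uniq =
    trans (sum-indicator-≡ a _ (λ x x≢a → indicator-no (mem? P x) (x≢a ∘ uniq))) (indicator-yes (mem? P a) Pa)

  #-remove : ∀ P a → P ∋ a → # P ≡ suc (# (P - a))
  #-remove P a Pa = trans (#-split P ⟨ a ⟩)
    (cong (_+ # (P - a)) (#-singleton (P ∩ ⟨ a ⟩) a (Pa , refl) proj₂))

  #-remove-≤ : ∀ P a → # P ≤ suc (# (P - a))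
  #-remove-≤ P a with mem? P a
  ... | yes Pa = ≤-reflexive (#-remove P a Pa)
  ... | no ¬Pa = m≤n⇒m≤1+n (#-mono {P} {P - a} (λ {x} Px → Px , λ { refl → ¬Pa Px }))

  #-∖-≤ : ∀ P Q → # P ≤ # Q + # (P ∖ Q)
  #-∖-≤ P Q = subst (_≤ # Q + # (P ∖ Q)) (sym (#-split P Q)) (+-monoˡ-≤ _ (#-mono {P ∩ Q} {Q} proj₂))

  #-list : ∀ L → # ⟨ L ⟩ˡ ≤ length L
  #-list []      = ≤-reflexive (#-empty ⟨ [] ⟩ˡ λ _ ())
  #-list (a ∷ L) = ≤-trans (#-remove-≤ ⟨ a ∷ L ⟩ˡ a)
    (s≤s (≤-trans (#-mono {⟨ a ∷ L ⟩ˡ - a} {⟨ L ⟩ˡ} λ { (here x≡a , x≢a) → ⊥-elim (x≢a x≡a) ; (there x∈L , _) → x∈L })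
                  (#-list L)))

  #-list-≥ : ∀ L → AllPairs _≢_ L → length L ≤ # ⟨ L ⟩ˡ
  #-list-≥ []      _             = z≤n
  #-list-≥ (a ∷ L) (a≢L ∷ uniq) = subst (suc (length L) ≤_) (sym (#-remove ⟨ a ∷ L ⟩ˡ a (here refl)))
    (s≤s (≤-trans (#-list-≥ L uniq) (#-mono {⟨ L ⟩ˡ} {⟨ a ∷ L ⟩ˡ - a} λ x∈L →
      there x∈L , λ { refl → All.lookup a≢L x∈L refl })))

  _∪_ : Subset → Subset → Subset
  P ∪ Q = record { _∋_ = λ x → P ∋ x ⊎ Q ∋ x ; mem? = λ x → mem? P x ⊎-dec mem? Q x }

  #-∪ : ∀ P Q → # (P ∪ Q) ≤ # P + # Q
  #-∪ P Q = ≤-trans (#-∖-≤ (P ∪ Q) P) (+-monoʳ-≤ (# P) (#-mono {(P ∪ Q) ∖ P} {Q} λ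
    { (inj₁ Px , ¬Px) → ⊥-elim (¬Px Px) ; (inj₂ Qx , _) → Qx }))

  search : ∀ P {B : V → Set} → (∀ x → Dec (B x)) →
           (∃[ x ] P ∋ x × B x) ⊎ (∀ {x} → P ∋ x → ¬ B x)
  search P B? with Fin.any? (λ x → mem? P x ×-dec B? x)
  ... | yes (x , Px , Bx) = inj₁ (x , Px , Bx)
  ... | no none           = inj₂ (λ Px Bx → none (_ , Px , Bx))

  elements : ∀ m P → m ≤ # P → ∃[ L ] length L ≡ m × AllPairs _≢_ L × All (P ∋_) L
  elements zero    P _   = [] , refl , [] , []
  elements (suc m) P m<P with a , Pa ← #-positive P (≤-trans (s≤s z≤n) m<P)
    with L , |L| , uniq , L⊆ ← elements m (P - a) (≤-pred (subst (suc m ≤_) (#-remove P a Pa) m<P)) =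
    a ∷ L , cong suc |L| , All.map (λ (_ , x≢a) a≡x → x≢a (sym a≡x)) L⊆ ∷ uniq , Pa ∷ All.map proj₁ L⊆

-- Independent sets, cliques and neighbourhoods.

module Graphs {n : ℕ} (G : Graph (Fin n)) where

  open Subsets n

  infix 4 _~_ _~?_
  _~_ : V → V → Set
  _~_ = Adj G

  _~?_ : ∀ u v → Dec (u ~ v)
  _~?_ = adj? G

  ~-sym : ∀ {u v} → u ~ v → v ~ u
  ~-sym = symm G

  ~⇒≢ : ∀ {u v} → u ~ v → u ≢ v
  ~⇒≢ u~v u≡v = irrefl G u≡v u~v

  N : V → Subset
  N v = record { _∋_ = v ~_ ; mem? = v ~?_ }

  N[_] : V → Subset
  N[ v ] = record { _∋_ = λ x → x ≡ v ⊎ v ~ x ; mem? = λ x → (x Fin.≟ v) ⊎-dec (v ~? x) }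

  Apart : V → V → Set
  Apart u v = u ≢ v × ¬ u ~ v

  apart-sym : ∀ {u v} → Apart u v → Apart v u
  apart-sym (u≢v , u≁v) = u≢v ∘ sym , u≁v ∘ ~-sym

  Independent : List V → Set
  Independent = AllPairs Apart

  record α≤ (k : ℕ) (P : Subset) : Set where
    constructor bounded
    field independent-≤ : ∀ L → Independent L → All (P ∋_) L → length L ≤ k

  open α≤ public

  α-⊆ : ∀ {k P Q} → P ⊆ Q → α≤ k Q → α≤ k P
  α-⊆ P⊆Q α = bounded λ L ind L⊆ → independent-≤ α L ind (All.map P⊆Q L⊆)

  Clique : Subset → Set
  Clique C = ∀ {x y} → C ∋ x → C ∋ y → x ≢ y → x ~ y

  α₀-empty : ∀ {P} → α≤ 0 P → # P ≤ 0
  α₀-empty {P} α = ≮⇒≥ λ 0<P → let x , Px = #-positive P 0<P in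
    <⇒≱ (s≤s z≤n) (independent-≤ α (x ∷ []) ([] ∷ []) (Px ∷ []))

  α-clique : ∀ {C} → Clique C → α≤ 1 C
  α-clique {C} cl = bounded at-most-one
    where
    at-most-one : ∀ L → Independent L → All (C ∋_) L → length L ≤ 1
    at-most-one []          _ _ = z≤n
    at-most-one (_ ∷ [])    _ _ = s≤s z≤n
    at-most-one (_ ∷ _ ∷ _) (((x≢y , x≁y) ∷ _) ∷ _) (Cx ∷ Cy ∷ _) = ⊥-elim (x≁y (cl Cx Cy x≢y))

  α₁-clique : ∀ {P} → α≤ 1 P → Clique P
  α₁-clique α {x} {y} Px Py x≢y with x ~? y
  ... | yes x~y = x~y
  ... | no x≁y  with s≤s () ← independent-≤ α (x ∷ y ∷ []) (((x≢y , x≁y) ∷ []) ∷ [] ∷ []) (Px ∷ Py ∷ [])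

  α-∖N : ∀ {k P v} → P ∋ v → α≤ (suc k) P → α≤ k (P ∖ N[ v ])
  α-∖N {v = v} Pv α = bounded λ L ind L⊆ → ≤-pred
    (independent-≤ α (v ∷ L) (All.map (λ (_ , out) → out ∘ inj₁ ∘ sym , out ∘ inj₂) L⊆ ∷ ind) (Pv ∷ All.map proj₁ L⊆))

  -- Matchings in sets of bounded independence number.

  data Match (P : Subset) : ℕ → Set where
    ∅    : Match P 0
    pair : ∀ {m a b} → P ∋ a → P ∋ b → a ~ b → Match (P - a - b) m → Match P (suc m)

  match-⊆ : ∀ {m P Q} → P ⊆ Q → Match P m → Match Q m
  match-⊆ P⊆Q ∅ = ∅
  match-⊆ P⊆Q (pair Pa Pb a~b M) =
    pair (P⊆Q Pa) (P⊆Q Pb) a~b (match-⊆ (λ ((Px , x≢a) , x≢b) → (P⊆Q Px , x≢a) , x≢b) M)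

  match-∪ : ∀ {m m′ P P′ R} → P ⊆ R → P′ ⊆ R → (∀ {x} → P ∋ x → ¬ P′ ∋ x) →
            Match P m → Match P′ m′ → Match R (m + m′)
  match-∪ P⊆R P′⊆R dis ∅ M′ = match-⊆ P′⊆R M′
  match-∪ P⊆R P′⊆R dis (pair Pa Pb a~b M) M′ = pair (P⊆R Pa) (P⊆R Pb) a~b
    (match-∪ (λ ((Px , x≢a) , x≢b) → (P⊆R Px , x≢a) , x≢b)
      (λ P′x → (P′⊆R P′x , λ { refl → dis Pa P′x }) , λ { refl → dis Pb P′x })
      (λ ((Px , _) , _) → dis Px) M M′)

  edge? : ∀ P → (∃[ a ] ∃[ b ] P ∋ a × P ∋ b × a ~ b) ⊎ (∀ {a b} → P ∋ a → P ∋ b → ¬ a ~ b)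
  edge? P with search P {λ a → ∃[ b ] P ∋ b × a ~ b} (λ a → Fin.any? (λ b → mem? P b ×-dec (a ~? b)))
  ... | inj₁ (a , Pa , b , Pb , a~b) = inj₁ (a , b , Pa , Pb , a~b)
  ... | inj₂ none = inj₂ (λ Pa Pb a~b → none Pa (_ , Pb , a~b))

  edgeless-independent : ∀ {P L} → (∀ {a b} → P ∋ a → P ∋ b → ¬ a ~ b) →
                         AllPairs _≢_ L → All (P ∋_) L → Independent L
  edgeless-independent {P} none [] [] = []
  edgeless-independent {P} none (x≢ ∷ uniq) (Px ∷ L⊆) =
    All.zipWith (λ (x≢y , Py) → x≢y , none Px Py) (x≢ , L⊆) ∷ edgeless-independent {P} none uniq L⊆

  edge : ∀ {k} P → α≤ k P → k < # P → ∃[ a ] ∃[ b ] P ∋ a × P ∋ b × a ~ b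
  edge {k} P α k<P with edge? P
  ... | inj₁ e = e
  ... | inj₂ none with L , |L| , uniq , L⊆ ← elements (suc k) P k<P =
    ⊥-elim (<-irrefl refl (subst (_≤ k) |L| (independent-≤ α L (edgeless-independent {P} none uniq L⊆) L⊆)))

  α-remove : ∀ {k P} a b → α≤ k P → α≤ k (P - a - b)
  α-remove a b = α-⊆ (proj₁ ∘ proj₁)

  #-remove² : ∀ P a b → # P ≤ 2 + # (P - a - b)
  #-remove² P a b = ≤-trans (#-remove-≤ P a) (s≤s (#-remove-≤ (P - a) b))

  -- As long as more than `k` vertices remain, they are not independent and span an edge; deleting
  -- its two ends costs two vertices.
  greedy : ∀ m {k} P → α≤ k P → 2 * m + k ≤ suc (# P) → Match P m
  greedy zero    P α big = ∅
  greedy (suc m) {k} P α big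
    with a , b , Pa , Pb , a~b ← edge P α (greedy-edge m k (# P) big) =
    pair Pa Pb a~b
      (greedy m (P - a - b) (α-remove a b α) (greedy-step m k (# P) _ big (#-remove² P a b)))

  -- A set too small for the greedy bound by one vertex still has a large
  -- matching as soon as adjacency is not transitive on it.
  path-match : ∀ m {k} P {a b c} → α≤ k P → P ∋ a → P ∋ b → P ∋ c →
               a ~ b → b ~ c → Apart a c → 2 * m + k ≤ # P + 2 → Match P m
  path-match 0 P α Pa Pb Pc a~b b~c ac big = ∅
  path-match 1 P α Pa Pb Pc a~b b~c ac big = pair Pa Pb a~b ∅
  -- An edge `e f` avoiding `b` meets the path in at most one vertex, because `a ≁ c`. If it meets
  -- `a` or `c`, the path edge at the opposite end completes the matching; otherwise `a b` does.
  path-match 2 {k} P {a} {b} {c} α Pa Pb Pc a~b b~c (a≢c , a≁c) big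
    with e , f , (Pe , e≢b) , (Pf , f≢b) , e~f
       ← edge (P - b) (α-⊆ proj₁ α) (path-edge₂ k (# P) (# (P - b)) big (#-remove-≤ P b))
    = cases (e Fin.≟ a) (e Fin.≟ c) (f Fin.≟ a) (f Fin.≟ c)
    where
    cases : Dec (e ≡ a) → Dec (e ≡ c) → Dec (f ≡ a) → Dec (f ≡ c) → Match P 2
    cases (yes refl) _ _ _ = pair Pa Pf e~f
      (pair ((Pb , e≢b ∘ sym) , f≢b ∘ sym) ((Pc , a≢c ∘ sym) , λ { refl → a≁c e~f }) b~c ∅)
    cases _ (yes refl) _ _ = pair Pc Pf e~f
      (pair ((Pb , e≢b ∘ sym) , f≢b ∘ sym) ((Pa , a≢c) , λ { refl → a≁c (~-sym e~f) }) (~-sym a~b) ∅)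
    cases _ _ (yes refl) _ = pair Pa Pe (~-sym e~f)
      (pair ((Pb , f≢b ∘ sym) , e≢b ∘ sym) ((Pc , a≢c ∘ sym) , λ { refl → a≁c (~-sym e~f) }) b~c ∅)
    cases _ _ _ (yes refl) = pair Pc Pe (~-sym e~f)
      (pair ((Pb , f≢b ∘ sym) , e≢b ∘ sym) ((Pa , a≢c) , λ { refl → a≁c e~f }) (~-sym a~b) ∅)
    cases (no e≢a) (no e≢c) (no f≢a) (no f≢c) = pair Pe Pf e~f
      (pair ((Pa , e≢a ∘ sym) , f≢a ∘ sym) ((Pb , e≢b ∘ sym) , f≢b ∘ sym) a~b ∅)
  -- Here there are enough vertices to split off an edge disjoint from the whole path, which
  -- therefore survives into the recursion.
  path-match (suc (suc (suc m))) {k} P {a} {b} {c} α Pa Pb Pc a~b b~c ac big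
    = let e , f , (((Pe , e≢a) , e≢b) , e≢c) , (((Pf , f≢a) , f≢b) , f≢c) , e~f =
            edge (P - a - b - c) (α-⊆ (proj₁ ∘ proj₁ ∘ proj₁) α)
              (path-edge m k (# P) _ _ big (#-remove² P a b) (#-remove-≤ (P - a - b) c)) in
    pair Pe Pf e~f (
    path-match (suc (suc m)) (P - e - f) (α-remove e f α)
      ((Pa , e≢a ∘ sym) , f≢a ∘ sym) ((Pb , e≢b ∘ sym) , f≢b ∘ sym) ((Pc , e≢c ∘ sym) , f≢c ∘ sym)
      a~b b~c ac (path-step m k (# P) _ big (#-remove² P e f)))

  insert : V → Subset → Subset
  insert a P = record { _∋_ = λ x → x ≡ a ⊎ P ∋ x ; mem? = λ x → (x Fin.≟ a) ⊎-dec mem? P x }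

  #-insert : ∀ a P → ¬ P ∋ a → # (insert a P) ≡ suc (# P)
  #-insert a P ¬Pa = trans (#-remove (insert a P) a (inj₁ refl))
    (cong suc (≤-antisym
      (#-mono {insert a P - a} {P} λ { (inj₁ x≡a , x≢a) → ⊥-elim (x≢a x≡a) ; (inj₂ Px , _) → Px })
      (#-mono {P} {insert a P - a} λ Px → inj₂ Px , λ { refl → ¬Pa Px })))

  -- Maximal cliques, and domination by maximum independent sets.

  record MaximalClique (S Q : Subset) : Set where
    field
      inside  : Q ⊆ S
      clique  : Clique Q
      maximal : ∀ {z} → S ∋ z → ¬ Q ∋ z → ∃[ x ] Q ∋ x × ¬ z ~ x

  -- Vertices adjacent to all of `C` are added one at a time. Each trades one unit of fuel for one
  -- vertex, so running out of fuel would mean a clique of more than `B` vertices.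
  extend-clique : ∀ fuel {S C B} → (∀ C → C ⊆ S → Clique C → # C ≤ B) → B < # C + fuel → C ⊆ S → Clique C →
                  Σ Subset λ Q → C ⊆ Q × MaximalClique S Q
  extend-clique zero {S} {C} {B} bound fuel C⊆S cl =
    ⊥-elim (<-irrefl refl (<-≤-trans fuel (subst (_≤ B) (sym (+-identityʳ _)) (bound C C⊆S cl))))
  extend-clique (suc fuel) {S} {C} {B} bound B< C⊆S cl
    with search (S ∖ C) {λ z → ∀ x → C ∋ x → z ~ x} (λ z → all-adjacent? z)
    where
    all-adjacent? : ∀ z → Dec (∀ x → C ∋ x → z ~ x)
    all-adjacent? z = Fin.all? (λ x → mem? C x →-dec (z ~? x))
  ... | inj₁ (z , (Sz , ¬Cz) , full~)
    with Q , C⊆Q , max ← extend-clique fuel {S} {insert z C} bound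
           (subst (B <_) (trans (+-suc (# C) fuel) (cong (_+ fuel) (sym (#-insert z C ¬Cz)))) B<)
           (λ { (inj₁ refl) → Sz ; (inj₂ Cx) → C⊆S Cx })
           (λ { (inj₁ refl) (inj₁ refl) z≢z → ⊥-elim (z≢z refl)
              ; (inj₁ refl) (inj₂ Cy) _ → full~ _ Cy
              ; (inj₂ Cx) (inj₁ refl) _ → ~-sym (full~ _ Cx)
              ; (inj₂ Cx) (inj₂ Cy) x≢y → cl Cx Cy x≢y })
    = Q , C⊆Q ∘ inj₂ , max
  extend-clique (suc fuel) {S} {C} {B} bound B< C⊆S cl | inj₂ none =
    C , id , record { inside = C⊆S ; clique = cl ; maximal = missing }
    where
    missing : ∀ {z} → S ∋ z → ¬ C ∋ z → ∃[ x ] C ∋ x × ¬ z ~ x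
    missing {z} Sz ¬Cz with search C (λ x → ¬? (z ~? x))
    ... | inj₁ found = found
    ... | inj₂ all~ = ⊥-elim (none (Sz , ¬Cz) (λ x Cx → decidable-stable (z ~? x) (all~ Cx)))

  -- A set exceeding the bound for independence number `k` contains an independent set of `suc k`
  -- vertices. The form is a refutation because every use ends in a contradiction.
  independent-set : ∀ k P B → (α≤ k P → # P ≤ B) → B < # P →
                    (∀ I → Independent I → length I ≡ suc k → All (P ∋_) I → ⊥) → ⊥
  independent-set k P B bound B<P absurd = <⇒≱ B<P (bound (bounded α))
    where
    α : ∀ L → Independent L → All (P ∋_) L → length L ≤ k
    α L ind L⊆ with length L ≤? k
    ... | yes |L|≤k = |L|≤k
    ... | no  |L|≰k = ⊥-elim (absurd (take (suc k) L) (AllPairs.take⁺ (suc k) ind)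
      (trans (length-take (suc k) L) (m≤n⇒m⊓n≡m (≰⇒> |L|≰k))) (All.take⁺ (suc k) L⊆))

  -- Otherwise `x ∷ I` would be an independent set of more than `k` vertices.
  dominated : ∀ {k S I x} → α≤ k S → Independent I → length I ≡ k → All (S ∋_) I →
              S ∋ x → All (_≢ x) I → Any (_~ x) I
  dominated {I = I} {x} α ind refl I⊆S Sx x∉I with Any.any? (_~? x) I
  ... | yes i~x = i~x
  ... | no none = ⊥-elim (<-irrefl refl
    (independent-≤ α (x ∷ I) (All.zipWith (λ (i≢x , i≁x) → i≢x ∘ sym , i≁x ∘ ~-sym) (x∉I , All.¬Any⇒All¬ I none) ∷ ind)
       (Sx ∷ I⊆S)))

  -- Call a vertex with a single neighbour in `Q` a leaf; by the last hypothesis only leaves reach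
  -- `X`. Going through `I`, a member adjacent to a vertex of `X` still present takes away that
  -- vertex alone and is counted by `s`; any other takes at most `M` vertices of `Q`, none of them
  -- in the present `X`, and is counted by `t`.
  cover-count : ∀ I {Q X M} → X ⊆ Q → (∀ {q} → Q ∋ q → Any (_~ q) I) →
                All (λ i → # (Q ∩ N i) ≤ M) I →
                All (λ i → ∀ x q → X ∋ x → i ~ x → Q ∋ q → i ~ q → q ≡ x) I →
                ∃[ s ] ∃[ t ] s + t ≡ length I × # X ≤ s × # Q ≤ s + M * t
  cover-count [] {Q} {X} X⊆Q cov _ _ = 0 , 0 , refl ,
    ≤-reflexive (#-empty X λ x Xx → case cov (X⊆Q Xx) of λ ()) ,
    ≤-trans (≤-reflexive (#-empty Q λ x Qx → case cov Qx of λ ())) z≤n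
  cover-count (i ∷ I) {Q} {X} {M} X⊆Q cov (i≤M ∷ ≤M) (i-leaf ∷ leaf) with search X (i ~?_)
  ... | inj₁ (x , Xx , i~x)
    with s , t , s+t , X≤s , Q≤ ← cover-count I {Q - x} {X - x} {M} (λ (Xy , y≢x) → X⊆Q Xy , y≢x)
           (λ (Qq , q≢x) → Any.tail (λ i~q → q≢x (i-leaf _ _ Xx i~x Qq i~q)) (cov Qq))
           (All.map (λ {j} → ≤-trans (#-mono {(Q - x) ∩ N j} {Q ∩ N j} λ ((Qq , _) , j~q) → Qq , j~q)) ≤M)
           (All.map (λ f y q (Xy , _) i~y (Qq , _) → f y q Xy i~y Qq) leaf) =
    suc s , t , cong suc s+t ,
    ≤-trans (#-remove-≤ X x) (s≤s X≤s) , ≤-trans (#-remove-≤ Q x) (s≤s Q≤)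
  cover-count (i ∷ I) {Q} {X} {M} X⊆Q cov (i≤M ∷ ≤M) (i-leaf ∷ leaf) | inj₂ i≁X
    with s , t , s+t , X≤s , Q≤ ← cover-count I {Q ∖ N i} {X} {M} (λ Xy → X⊆Q Xy , i≁X Xy)
           (λ (Qq , i≁q) → Any.tail i≁q (cov Qq))
           (All.map (λ {j} → ≤-trans (#-mono {(Q ∖ N i) ∩ N j} {Q ∩ N j} λ ((Qq , _) , j~q) → Qq , j~q)) ≤M)
           (All.map (λ f y q Xy i~y (Qq , _) → f y q Xy i~y Qq) leaf) =
    s , suc t , trans (+-suc s t) (cong suc s+t) , X≤s ,
    subst (_≤ s + M * suc t) (sym (#-split Q (N i))) (cover-step s t (# (Q ∩ N i)) (# (Q ∖ N i)) M i≤M Q≤)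

  -- Private neighbourhoods, degrees and double counting.

  total : (V → ℕ) → List V → ℕ
  total f []      = 0
  total f (i ∷ L) = f i + total f L

  total-≤ : ∀ {f c} L → All (λ i → f i ≤ c) L → total f L ≤ length L * c
  total-≤ []      []            = z≤n
  total-≤ (i ∷ L) (fi≤c ∷ rest) = +-mono-≤ fi≤c (total-≤ L rest)

  total-≥ : ∀ {f c L} → Any (λ i → c ≤ f i) L → c ≤ total f L
  total-≥ {f} {L = i ∷ L} (here c≤fi) = ≤-trans c≤fi (m≤m+n (f i) (total f L))
  total-≥ {f} {L = i ∷ L} (there any) = ≤-trans (total-≥ any) (m≤n+m (total f L) (f i))

  total-≥₂ : ∀ {f i j L} → i ≢ j → i ∈ L → j ∈ L → 1 ≤ f i → 1 ≤ f j → 2 ≤ total f L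
  total-≥₂ i≢j (here refl) (here refl) _ _ = ⊥-elim (i≢j refl)
  total-≥₂ i≢j (here refl) (there j∈) 1≤fi 1≤fj = +-mono-≤ 1≤fi (total-≥ (Any.map (λ { refl → 1≤fj }) j∈))
  total-≥₂ i≢j (there i∈) (here refl) 1≤fi 1≤fj = +-mono-≤ 1≤fj (total-≥ (Any.map (λ { refl → 1≤fi }) i∈))
  total-≥₂ {f} {L = h ∷ L} i≢j (there i∈) (there j∈) 1≤fi 1≤fj =
    ≤-trans (total-≥₂ i≢j i∈ j∈ 1≤fi 1≤fj) (m≤n+m (total f L) (f h))

  total-sum : ∀ (h : V → V → ℕ) L → total (λ i → sum (h i)) L ≡ sum (λ x → total (λ i → h i x) L)
  total-sum h []      = sym (sum-zero {n} _ (λ _ → refl))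
  total-sum h (i ∷ L) = trans (cong (sum (h i) +_) (total-sum h L)) (sym (∑-distrib-+ {n} (h i) _))

  drop-element : ∀ {i I} → i ∈ I → Independent I →
                 ∃[ J ] length I ≡ suc (length J) × Independent J ×
                        (∀ {P : V → Set} → All P I → All P J) × All (λ j → j ∈ I × j ≢ i) J
  drop-element {I = _ ∷ I} (here refl) (i-apart ∷ ind) =
    I , refl , ind , All.tail , All.tabulate (λ j∈ → there j∈ , proj₁ (All.lookup i-apart j∈) ∘ sym)
  drop-element {I = h ∷ I} (there i∈) (h-apart ∷ ind)
    with J , |I| , indJ , sub , other ← drop-element i∈ ind =
    h ∷ J , cong suc |I| , sub h-apart ∷ indJ , (λ { (Ph ∷ PI) → Ph ∷ sub PI }) ,
    (here refl , λ { refl → proj₁ (All.lookup h-apart i∈) refl }) ∷ All.map (λ (j∈ , j≢i) → there j∈ , j≢i) other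

  -- The private closed neighbourhood of `i` with respect to `I`, within `S`.
  Private : Subset → List V → V → Subset
  Private S I i = record
    { _∋_  = λ x → S ∋ x × N[ i ] ∋ x × All (λ j → N[ j ] ∋ x → j ≡ i) I
    ; mem? = λ x → mem? S x ×-dec mem? N[ i ] x ×-dec All.all? (λ j → mem? N[ j ] x →-dec (j Fin.≟ i)) I }

  -- Two nonadjacent private vertices could replace `i` in `I`, giving an independent set of `suc k`
  -- vertices.
  private-clique : ∀ {k S I i} → α≤ k S → Independent I → length I ≡ k → All (S ∋_) I →
                   i ∈ I → Clique (Private S I i)
  private-clique {S = S} {I} {i} α ind |I| I⊆S i∈I {x} {y} (Sx , _ , x-only) (Sy , _ , y-only) x≢y
    with x ~? y
  ... | yes x~y = x~y
  ... | no x≁y with J , |J| , indJ , sub , other ← drop-element i∈I ind =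
    ⊥-elim (<-irrefl (trans (sym |J|) |I|)
      (independent-≤ α (x ∷ y ∷ J) (((x≢y , x≁y) ∷ apart x-only other) ∷ apart y-only other ∷ indJ) (Sx ∷ Sy ∷ sub I⊆S)))
    where
    apart : ∀ {z J} → All (λ j → N[ j ] ∋ z → j ≡ i) I → All (λ j → j ∈ I × j ≢ i) J → All (Apart z) J
    apart only = All.map λ (j∈ , j≢i) →
      (λ { refl → j≢i (All.lookup only j∈ (inj₁ refl)) }) , (λ z~j → j≢i (All.lookup only j∈ (inj₂ (~-sym z~j))))

  deg : Subset → V → ℕ
  deg S v = # (S ∩ N v)

  #-closed : ∀ S v → # (S ∩ N[ v ]) ≤ suc (deg S v)
  #-closed S v = ≤-trans (#-remove-≤ (S ∩ N[ v ]) v) (s≤s (#-mono {(S ∩ N[ v ]) - v} {S ∩ N v}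
    λ { ((_ , inj₁ x≡v) , x≢v) → ⊥-elim (x≢v x≡v) ; ((Sx , inj₂ v~x) , _) → Sx , v~x }))

  #-degree : ∀ S v → # S ≤ suc (deg S v) + # (S ∖ N[ v ])
  #-degree S v = subst (_≤ suc (deg S v) + # (S ∖ N[ v ])) (sym (#-split S N[ v ]))
    (+-monoˡ-≤ _ (#-closed S v))

  -- Inclusion and exclusion for two closed neighbourhoods: a common neighbour is counted in both
  -- degrees.
  #-codegree : ∀ S a b → # S + # (S ∩ N a ∩ N b) ≤ suc (deg S a) + suc (deg S b) + # (S ∖ N[ a ] ∖ N[ b ])
  #-codegree S a b = codegree-sum (# S) _ _ _ _ _ _ _ (#-degree S a)
    (#-split (S ∖ N[ a ]) N[ b ])
    (≤-trans (#-remove-≤ ((S ∖ N[ a ]) ∩ N[ b ]) b) (s≤s (#-mono {((S ∖ N[ a ]) ∩ N[ b ]) - b} {(S ∩ N b) ∖ N a}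
      λ { ((_ , inj₁ x≡b) , x≢b) → ⊥-elim (x≢b x≡b)
        ; (((Sx , x∉) , inj₂ b~x) , _) → (Sx , b~x) , x∉ ∘ inj₂ })))
    (#-split (S ∩ N b) (N a))
    (#-mono {S ∩ N a ∩ N b} {(S ∩ N b) ∩ N a} λ (Sx , a~x , b~x) → (Sx , b~x) , a~x)

  -- A vertex of S lies in two of the closed neighbourhoods N[i], or in exactly
  -- one N[i] and then also in the clique Private S I i.
  #-private : ∀ {k S I} c → α≤ k S → Independent I → length I ≡ k → All (S ∋_) I →
              (∀ v C → S ∋ v → C ∋ v → C ⊆ S → Clique C → # C + suc (deg S v) ≤ c) →
              2 * # S ≤ k * c
  #-private {k} {S} {I} c α ind |I| I⊆S bound = begin
    2 * # S                                    ≡⟨ cong (# S +_) (+-identityʳ (# S)) ⟩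
    # S + # S                                  ≡⟨ ∑-distrib-+ {n} _ _ ⟨
    sum (λ x → indicator (mem? S x) + indicator (mem? S x))  ≤⟨ sum-mono pointwise ⟩
    sum (λ x → total (λ i → h i x) I)          ≡⟨ total-sum h I ⟨
    total (λ i → sum (h i)) I                  ≤⟨ total-≤ I (All.tabulate each) ⟩
    length I * c                               ≡⟨ cong (_* c) |I| ⟩
    k * c                                      ∎
    where
    open ≤-Reasoning
    h : V → V → ℕ
    h i x = indicator (mem? (S ∩ N[ i ]) x) + indicator (mem? (Private S I i) x)
    each : ∀ {i} → i ∈ I → sum (h i) ≤ c
    each {i} i∈ = begin
      sum (h i)                             ≡⟨ ∑-distrib-+ {n} _ _ ⟩
      # (S ∩ N[ i ]) + # (Private S I i)    ≡⟨ +-comm (# (S ∩ N[ i ])) _ ⟩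
      # (Private S I i) + # (S ∩ N[ i ])    ≤⟨ +-monoʳ-≤ (# (Private S I i)) (#-closed S i) ⟩
      # (Private S I i) + suc (deg S i)     ≤⟨ bound i (Private S I i) Si i-private proj₁
                                                (private-clique α ind |I| I⊆S i∈) ⟩
      c                                     ∎
      where
      Si = All.lookup I⊆S i∈
      only : ∀ {L} → Independent L → i ∈ L → All (λ j → N[ j ] ∋ i → j ≡ i) L
      only (i-apart ∷ ind) (here refl) = (λ _ → refl) ∷
        All.map (λ (i≢j , i≁j) → λ { (inj₁ i≡j) → ⊥-elim (i≢j i≡j) ; (inj₂ j~i) → ⊥-elim (i≁j (~-sym j~i)) }) i-apart
      only (h-apart ∷ ind) (there i∈) =
        (λ { (inj₁ i≡h) → sym i≡h ; (inj₂ h~i) → ⊥-elim (proj₂ (All.lookup h-apart i∈) h~i) }) ∷ only ind i∈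
      -- Since `i` lies in its own private clique, `bound` is asked only for cliques through `v`;
      -- the case of independence number 5 relies on this.
      i-private : Private S I i ∋ i
      i-private = Si , inj₁ refl , only ind i∈
    near : ∀ {x} → S ∋ x → ∃[ i ] i ∈ I × N[ i ] ∋ x
    near {x} Sx with Any.any? (x Fin.≟_) I
    ... | yes x∈I = x , x∈I , inj₁ refl
    ... | no x∉I with i , i∈I , i~x ← find (dominated α ind |I| I⊆S Sx
                   (All.map (λ x≢i i≡x → x≢i (sym i≡x)) (All.¬Any⇒All¬ I x∉I))) = i , i∈I , inj₂ i~x
    hit : ∀ {i x} → S ∋ x → N[ i ] ∋ x → 1 ≤ indicator (mem? (S ∩ N[ i ]) x)
    hit Sx i∋x = ≤-reflexive (sym (indicator-yes (mem? (S ∩ N[ _ ]) _) (Sx , i∋x)))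
    twice : ∀ x → S ∋ x → 2 ≤ total (λ i → h i x) I
    twice x Sx with i , i∈I , i∋x ← near Sx
      with Any.any? (λ j → mem? N[ j ] x ×-dec ¬? (j Fin.≟ i)) I
    ... | yes another with j , j∈I , j∋x , j≢i ← find another =
      total-≥₂ (j≢i ∘ sym) i∈I j∈I (≤-trans (hit Sx i∋x) (m≤m+n _ _)) (≤-trans (hit Sx j∋x) (m≤m+n _ _))
    ... | no none = total-≥ (Any.map (λ { refl → +-mono-≤ (hit Sx i∋x)
      (≤-reflexive (sym (indicator-yes (mem? (Private S I i) x) (Sx , i∋x , only)))) }) i∈I)
      where
      only : All (λ j → N[ j ] ∋ x → j ≡ i) I
      only = All.map (λ {j} ¬other j∋x → decidable-stable (j Fin.≟ i) (λ j≢i → ¬other (j∋x , j≢i))) (All.¬Any⇒All¬ I none)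
    pointwise : ∀ x → indicator (mem? S x) + indicator (mem? S x) ≤ total (λ i → h i x) I
    pointwise x = weigh (mem? S x) (twice x)
      where
      weigh : ∀ {A t} (d : Dec A) → (A → 2 ≤ t) → indicator d + indicator d ≤ t
      weigh (yes a) f = f a
      weigh (no _)  f = z≤n

-- Upper bounds for graphs whose neighbourhoods contain no ℓ disjoint edges.

-- ℓ = 6 + m, so that no subtraction occurs; for instance 2ℓ − 2 is 2 * m + 10.
module FanFree {n : ℕ} (G : Graph (Fin n)) (m : ℕ) where

  open Subsets n
  open Graphs G

  Below : ℕ → ℕ → Subset → Set₁
  Below k B S = ∀ P → P ⊆ S → α≤ k P → # P ≤ B

  covers : ∀ {k S Q Y I} → α≤ k S → Q ⊆ S → Q ⊆ Y → Independent I → length I ≡ k → All ((S ∖ Y) ∋_) I →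
           ∀ {q} → Q ∋ q → Any (_~ q) I
  covers α Q⊆S Q⊆Y ind |I| I⊆ Qq =
    dominated α ind |I| (All.map proj₁ I⊆) (Q⊆S Qq) (All.map (λ { (_ , i∉Y) refl → i∉Y (Q⊆Y Qq) }) I⊆)

  -- The deletion argument behind all exclusions of cliques: more than `B` vertices survive outside
  -- `Y`, so they contain an independent set of `suc k` vertices, which is maximum in `S` and hence
  -- dominates `Q`; `cover-count` then applies.
  clique-count : ∀ k B S Q Y X M → α≤ (suc k) S → Below k B S → Q ⊆ S → Q ⊆ Y → B < # (S ∖ Y) → X ⊆ Q →
                 (∀ {i} → S ∋ i → ¬ Y ∋ i → # (Q ∩ N i) ≤ M) →
                 (∀ {i x q} → S ∋ i → ¬ Y ∋ i → X ∋ x → i ~ x → Q ∋ q → i ~ q → q ≡ x) →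
                 (∀ s t → s + t ≡ suc k → # X ≤ s → # Q ≤ s + M * t → ⊥) → ⊥
  clique-count k B S Q Y X M α below Q⊆S Q⊆Y B< X⊆Q ≤M leaf absurd =
    independent-set k (S ∖ Y) B (below (S ∖ Y) proj₁) B< λ I ind |I| I⊆ →
      let s , t , s+t , X≤s , Q≤ = cover-count I {Q} {X} {M} X⊆Q
            (λ {q} → covers {S = S} {Q} {Y} α Q⊆S Q⊆Y ind |I| I⊆ {q})
            (All.map (λ (Si , i∉Y) → ≤M Si i∉Y) I⊆)
            (All.map (λ (Si , i∉Y) x q → leaf Si i∉Y) I⊆)
      in absurd s t (trans s+t |I|) X≤s Q≤

  Small : Subset → Set₁
  Small S = ∀ C → C ⊆ S → Clique C → # C ≤ 2 * m + 10

  maximal-clique : ∀ {S} C → Small S → C ⊆ S → Clique C → Σ Subset λ Q → C ⊆ Q × MaximalClique S Q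
  maximal-clique C small = extend-clique (suc (2 * m + 10)) {C = C} small (m≤n+m _ (# C))

  clique-rest : ∀ {B} S Q y → # Q ≤ y → suc B + y ≤ # S → B < # (S ∖ Q)
  clique-rest {B} S Q y Q≤y h = rest-> B y (# S) _ (# Q) h (#-∖-≤ S Q) Q≤y

  few-private : ∀ k B S c → α≤ (suc k) S → Below k B S → B < # S →
                (∀ v C → S ∋ v → C ∋ v → C ⊆ S → Clique C → # C + suc (deg S v) ≤ c) →
                suc k * c < 2 * # S → ⊥
  few-private k B S c α below B< bound big = independent-set k S B (below S id) B< λ I ind |I| I⊆S →
    <⇒≱ big (#-private c α ind |I| I⊆S bound)

  min-degree : ∀ k B S b {v} → α≤ (suc k) S → Below k B S → suc b + B ≤ # S → S ∋ v → b ≤ deg S v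
  min-degree k B S b {v} α below h Sv = degree-≥ b (# S) (deg S v) _ B h (#-degree S v)
    (below (S ∖ N[ v ]) proj₁ (α-∖N Sv α))

  module _ (fan-free : ∀ v → ¬ Match (N v) (6 + m)) where

    deg-≤ : ∀ {k} S v → α≤ k S → deg S v ≤ 2 * m + 10 + k
    deg-≤ {k} S v α = ≮⇒≥ λ big → fan-free v (match-⊆ proj₂
      (greedy (6 + m) (S ∩ N v) (α-⊆ proj₁ α) (deg-step m k _ big)))

    -- The largest degree permitted by deg-≤.
    Top : ℕ → Subset → V → Set
    Top k S v = 2 * m + 10 + k ≤ deg S v

    -- A failure is an induced path on three vertices in the neighbourhood of `v`; `path-match` then
    -- makes up for the one vertex that `greedy` lacks.
    top-transitive : ∀ {k S v a b c} → α≤ k S → Top k S v → S ∋ a → S ∋ b → S ∋ c → v ~ a → v ~ b → v ~ c →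
                     a ~ b → b ~ c → a ≢ c → a ~ c
    top-transitive {k} {S} {v} {a} {c = c} α top Sa Sb Sc v~a v~b v~c a~b b~c a≢c with a ~? c
    ... | yes a~c = a~c
    ... | no a≁c = ⊥-elim (fan-free v (match-⊆ proj₂
      (path-match (6 + m) (S ∩ N v) (α-⊆ proj₁ α) (Sa , v~a) (Sb , v~b) (Sc , v~c) a~b b~c (a≢c , a≁c)
        (top-step m k _ top))))

    -- Let `z` be a vertex of `Q` missed by `y`. A second neighbour `q` of `y` would give the path
    -- `y q z` inside `N x`, and `top-transitive` would make `y` adjacent to `z`.
    top-leaf : ∀ {k S Q x y q} → α≤ k S → MaximalClique S Q → Q ∋ x → Top k S x →
               S ∋ y → ¬ Q ∋ y → y ~ x → Q ∋ q → y ~ q → q ≡ x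
    top-leaf {Q = Q} {x} {y} {q} α mc Qx top Sy y∉Q y~x Qq y~q with q Fin.≟ x
    ... | yes q≡x = q≡x
    ... | no q≢x with z , Qz , y≁z ← MaximalClique.maximal mc Sy y∉Q =
      ⊥-elim (y≁z (top-transitive α top Sy (inside Qq) (inside Qz) (~-sym y~x)
        (clique Qx Qq (q≢x ∘ sym)) (clique Qx Qz (λ { refl → y≁z y~x }))
        y~q (clique Qq Qz (λ { refl → y≁z y~q })) (λ { refl → y∉Q Qz })))
      where open MaximalClique mc

    -- Every vertex dominating part of `Q` is a leaf, so `suc k` of them dominate at most `suc k`
    -- vertices. The value `# Q` for `M` is the trivial one.
    all-top : ∀ k B S Q → α≤ (suc k) S → Below k B S → MaximalClique S Q → B < # (S ∖ Q) →
              (∀ {x} → S ∋ x → Top (suc k) S x) → # Q ≤ suc k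
    all-top k B S Q α below mc B< top = ≮⇒≥ λ big →
      clique-count k B S Q Q Q (# Q) α below inside id B< id
        (λ {i} _ _ → #-mono {Q ∩ N i} {Q} proj₁)
        (λ Si i∉Q Qx → top-leaf α mc Qx (top (inside Qx)) Si i∉Q)
        (λ s t s+t Q≤s _ → <⇒≱ big (top-count (suc k) (# Q) s t s+t Q≤s))
      where open MaximalClique mc

    -- If z had c + 1 neighbours in Q, the codegree bound would force every x ∈ Q not adjacent
    -- to z to be top; such x are dominated by leaves only, so there are few of them.
    outside-degree : ∀ k c B B′ S Q {z} → α≤ (2 + k) S → Below k B S → Below (suc k) B′ S → MaximalClique S Q →
                     2 * (2 * m + 12 + k) + 2 + B ≤ # S + suc c → suc (suc k) + suc c ≤ # Q → B′ < # (S ∖ Q) →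
                     S ∋ z → ¬ Q ∋ z → # (Q ∩ N z) ≤ c
    outside-degree k c B B′ S Q {z} α below below′ mc large bigQ B′< Sz z∉Q = ≮⇒≥ λ c<a →
      let x , Qx , z≁x = maximal Sz z∉Q in
      clique-count (suc k) B′ S Q Q (Q ∖ N z) (# Q) α below′ inside id B′< proj₁
        (λ {i} _ _ → #-mono {Q ∩ N i} {Q} proj₁)
        (λ Si i∉Q (Qy , z≁y) → top-leaf α mc Qy (top c<a Qy z≁y) Si i∉Q)
        -- By `≤c` the vertex `z` has at most `suc c` neighbours in `Q`, so at least `2 + k`
        -- vertices of `Q` can be dominated by leaves only.
        (λ s t → outside-count (suc k) c (# Q) (# (Q ∩ N z)) (# (Q ∖ N z)) s t bigQ (#-split Q (N z)) (≤c Qx z≁x))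
      where
      open MaximalClique mc
      codegree : ∀ {x} → Q ∋ x → ¬ z ~ x →
                 # S + # (Q ∩ N z) ≤ suc (deg S z) + suc (deg S x) + # (S ∖ N[ z ] ∖ N[ x ])
      codegree {x} Qx z≁x = ≤-trans
        (+-monoʳ-≤ (# S) (#-mono {Q ∩ N z} {S ∩ N z ∩ N x}
          λ (Qy , z~y) → inside Qy , z~y , clique Qx Qy (λ { refl → z≁x z~y })))
        (#-codegree S z x)
      -- The vertices `z` and `x` are distinct and nonadjacent, so deleting both closed
      -- neighbourhoods lowers the independence number by two.
      rest : ∀ {x} → Q ∋ x → ¬ z ~ x → # (S ∖ N[ z ] ∖ N[ x ]) ≤ B
      rest {x} Qx z≁x = below (S ∖ N[ z ] ∖ N[ x ]) (proj₁ ∘ proj₁)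
        (α-∖N {P = S ∖ N[ z ]} (inside Qx , [ (λ { refl → z∉Q Qx }) , z≁x ]′) (α-∖N Sz α))
      top : c < # (Q ∩ N z) → ∀ {x} → Q ∋ x → ¬ z ~ x → Top (2 + k) S x
      top c<a Qx z≁x = codegree-top m k B (# S) (suc c) (# (Q ∩ N z)) (deg S z) (deg S _) _ large (codegree Qx z≁x)
        c<a (deg-≤ S z α) (rest Qx z≁x)
      ≤c : ∀ {x} → Q ∋ x → ¬ z ~ x → # (Q ∩ N z) ≤ suc c
      ≤c Qx z≁x = codegree-bound m k B (# S) (suc c) (# (Q ∩ N z)) (deg S z) (deg S _) _ large (codegree Qx z≁x)
        (deg-≤ S z α) (deg-≤ S _ α) (rest Qx z≁x)

    -- Exclusion of cliques of order 2ℓ - 1.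

    clique-has-match : ∀ c r q Q P → Clique Q → 2 * m + 2 * c + r ≤ q → q ≤ r + # P → P ⊆ Q → Match P (c + m)
    clique-has-match c r q Q P cl h h′ P⊆Q = greedy (c + m) P (α-⊆ P⊆Q (α-clique {Q} cl)) (clique-match m c q r h (# P) h′)

    -- Fix 2ℓ - 1 vertices `Q` of `C`. The bound on the number of neighbours in `Q` of an outside
    -- vertex is lowered one by one down to 2; then five vertices cover at most 10 < 2ℓ - 1 vertices
    -- of `Q`.
    exclusion : ∀ k S C → suc k ≤ 5 → α≤ (suc k) S → Below k ((2 * m + 12) * k) S →
                suc ((2 * m + 12) * suc k) ≤ # S → C ⊆ S → Clique C → 2 * m + 11 ≤ # C → ⊥
    exclusion k S C k<5 α below large C⊆S cl bigC
      with L , |L| , uniq , L⊆C ← elements (2 * m + 11) C bigC =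
      -- The descent starts from the trivial bound, `2 * m + 9 + 2` being the order of `Q`.
      descend (2 * m + 9) λ {z} _ _ → ≤-trans (#-mono {Q ∩ N z} {Q} proj₁)
        (≤-trans (#-list L) (≤-reflexive (trans |L| (sym (+-assoc (2 * m) 9 2)))))
      where
      Q : Subset
      Q = ⟨ L ⟩ˡ
      Q⊆C : Q ⊆ C
      Q⊆C x∈L = All.lookup L⊆C x∈L
      #Q : 2 * m + 11 ≤ # Q
      #Q = subst (_≤ # Q) |L| (#-list-≥ L uniq)
      #Q≤ : # Q ≤ 2 * m + 11
      #Q≤ = subst (# Q ≤_) |L| (#-list L)
      clQ : Clique Q
      clQ Qx Qy = cl (Q⊆C Qx) (Q⊆C Qy)
      -- Otherwise `N x` contains the edge `i q`, an edge `z q′` to a third neighbour of `z`, and a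
      -- perfect matching of the remaining 2ℓ - 4 vertices of `Q`: ℓ disjoint edges in all.
      leaf : ∀ {z i x q} → ¬ Q ∋ z → 3 ≤ # (Q ∩ N z) → ¬ insert z Q ∋ i →
             Q ∋ x → z ~ x → i ~ x → Q ∋ q → i ~ q → q ≡ x
      leaf {z} {i} {x} {q} z∉Q 3≤ i∉ Qx z~x i~x Qq i~q with q Fin.≟ x
      ... | yes q≡x = q≡x
      ... | no q≢x with q′ , ((Qq′ , z~q′) , q′≢x) , q′≢q
              ← #-positive (Q ∩ N z - x - q) (≤-pred (≤-pred (≤-trans 3≤ (#-remove² (Q ∩ N z) x q)))) =
        ⊥-elim (fan-free x
          (pair (~-sym i~x) (clQ Qx Qq (q≢x ∘ sym)) i~q
          (pair ((~-sym z~x , λ { refl → i∉ (inj₁ refl) }) , λ { refl → z∉Q Qq })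
                ((clQ Qx Qq′ (q′≢x ∘ sym) , λ { refl → i∉ (inj₂ Qq′) }) , q′≢q) z~q′
          (match-⊆ (λ (((Qy , y≢x) , y≢q) , y≢q′) →
                     (((clQ Qx Qy (y≢x ∘ sym) , λ { refl → i∉ (inj₂ Qy) }) , y≢q) , λ { refl → z∉Q Qy }) , y≢q′)
            (clique-has-match 4 3 (# Q) Q (Q - x - q - q′) clQ (≤-trans (≤-reflexive (+-assoc (2 * m) 8 3)) #Q)
              (≤-trans (#-remove² Q x q) (s≤s (s≤s (#-remove-≤ (Q - x - q) q′)))) (proj₁ ∘ proj₁ ∘ proj₁))))))
      -- With 3, 4 or 5 leaves among at most five vertices, the others cannot cover the rest of `Q`;
      -- six leaves are too many.
      finish : ∀ M s t → s + t ≡ suc k → suc M + 2 ≤ s → # Q ≤ s + (suc M + 2) * t → ⊥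
      finish 0 s t s+t M≤s Q≤ = exclusion-3 m (# Q) k s t k<5 #Q s+t M≤s Q≤
      finish 1 s t s+t M≤s Q≤ = exclusion-4 m (# Q) k s t k<5 #Q s+t M≤s Q≤
      finish 2 s t s+t M≤s Q≤ = exclusion-5 m (# Q) k s t k<5 #Q s+t M≤s Q≤
      finish (suc (suc (suc M))) s t s+t M≤s Q≤ = exclusion-6 M k s t k<5 s+t (s≤s (s≤s M≤s))
      descend : ∀ M → (∀ {z} → S ∋ z → ¬ Q ∋ z → # (Q ∩ N z) ≤ M + 2) → ⊥
      descend zero bound = clique-count k _ S Q Q ⟨ [] ⟩ˡ 2 α below (C⊆S ∘ Q⊆C) id
        (clique-rest S Q (2 * m + 11) #Q≤ (exclusion-size m k (# S) _ (+-monoʳ-≤ (2 * m) (n≤1+n 11)) large))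
        (λ ()) bound (λ _ _ ()) (λ s t s+t _ Q≤ → exclusion-2 m (# Q) k s t k<5 #Q s+t Q≤)
      descend (suc M) bound = descend M λ {z} Sz z∉Q → ≮⇒≥ λ big →
        -- Deleting `z` along with `Q` makes `leaf` applicable. Exactly 2ℓ vertices are lost, which
        -- the bound 2ℓk for the previous case just allows.
        clique-count k _ S Q (insert z Q) (Q ∩ N z) (suc M + 2) α below (C⊆S ∘ Q⊆C) inj₂
          (clique-rest S (insert z Q) (2 * m + 12)
            (≤-trans (≤-reflexive (#-insert z Q z∉Q)) (≤-trans (s≤s #Q≤) (≤-reflexive (sym (+-suc (2 * m) 11)))))
            (exclusion-size m k (# S) _ ≤-refl large))
          proj₁ (λ Si i∉ → bound Si (i∉ ∘ inj₂))
          (λ Si i∉ (Qx , z~x) i~x Qq i~q → leaf z∉Q (≤-trans (s≤s (m≤n+m 2 M)) big) i∉ Qx z~x i~x Qq i~q)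
          (λ s t s+t X≤s Q≤ → finish M s t s+t (≤-trans big X≤s) Q≤)

    -- The case |Q| = 2ℓ − 2 for k = 5.
    module ExtremalClique (S Q : Subset) (α : α≤ 5 S) (below : Below 4 (8 * m + 46) S) (mc : MaximalClique S Q)
                    (large : 10 * m + 61 ≤ # S) (#Q : 2 * m + 10 ≤ # Q) (#Q≤ : # Q ≤ 2 * m + 10)
                    (few : ∀ {z} → S ∋ z → ¬ Q ∋ z → # (Q ∩ N z) ≤ 3) where

      open MaximalClique mc

      NonLeaf : V → V → Set
      NonLeaf x y = S ∋ y × ¬ Q ∋ y × y ~ x × ∃[ q ] Q ∋ q × y ~ q × q ≢ x

      R : V → Subset
      R x = (S ∩ N x) ∖ Q

      -- The bound on non-neighbours forces degree at least `2 * m + 14`, and at most `2 * m + 9`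
      -- neighbours of `x` lie in `Q`.
      #R : ∀ {x} → Q ∋ x → 5 ≤ # (R x)
      #R {x} Qx = outside-≥5 m (deg S x) (# Q) (# (Q - x)) (# ((S ∩ N x) ∩ Q)) (# (R x))
        (min-degree 4 (8 * m + 46) S (2 * m + 14) α below
          (≤-trans (≤-reflexive (five-degree m)) large) (inside Qx))
        (#-split (S ∩ N x) Q)
        (#-mono {(S ∩ N x) ∩ Q} {Q - x} λ ((_ , x~y) , Qy) → Qy , λ { refl → ~⇒≢ x~y refl })
        (≤-reflexive (sym (#-remove Q x Qx))) #Q≤

      -- A matching of order ℓ in N x arises from an edge of R x and a disjoint edge to Q - x, or
      -- from three disjoint edges between R x and Q - x.
      edge-blocks : ∀ {x y₁ y₂ y} → Q ∋ x → R x ∋ y₁ → R x ∋ y₂ → y₁ ~ y₂ → NonLeaf x y → y ≢ y₁ → y ≢ y₂ → ⊥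
      edge-blocks {x} {y₁} {y₂} {y} Qx ((_ , x~y₁) , y₁∉Q) ((_ , x~y₂) , y₂∉Q) y₁~y₂
        (_ , y∉Q , y~x , q , Qq , y~q , q≢x) y≢y₁ y≢y₂ = fan-free x
          (pair x~y₁ x~y₂ y₁~y₂
          (pair ((~-sym y~x , y≢y₁) , y≢y₂)
                ((clique Qx Qq (q≢x ∘ sym) , λ { refl → y₁∉Q Qq }) , λ { refl → y₂∉Q Qq }) y~q
          (match-⊆ (λ ((Qv , v≢x) , v≢q) →
                     (((clique Qx Qv (v≢x ∘ sym) , λ { refl → y₁∉Q Qv }) , λ { refl → y₂∉Q Qv }) ,
                      λ { refl → y∉Q Qv }) , v≢q)
            (clique-has-match 4 2 (# Q) Q (Q - x - q) clique (≤-trans (≤-reflexive (+-assoc (2 * m) 8 2)) #Q)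
              (#-remove² Q x q) (proj₁ ∘ proj₁)))))

      -- The three nonadjacencies make the six ends distinct, and keep `q₂` and `q₃` away from `x`
      -- because `r₁` is adjacent to `x`.
      three-edges : ∀ {x r₁ r₂ r₃ q₁ q₂ q₃} → Q ∋ x → R x ∋ r₁ → R x ∋ r₂ → R x ∋ r₃ →
                    Q ∋ q₁ → q₁ ≢ x → Q ∋ q₂ → Q ∋ q₃ → r₁ ~ q₁ → r₂ ~ q₂ → r₃ ~ q₃ →
                    ¬ r₁ ~ q₂ → ¬ r₁ ~ q₃ → ¬ r₂ ~ q₃ → Match (N x) (6 + m)
      three-edges {x} {r₁} {r₂} {r₃} {q₁} {q₂} {q₃} Qx ((_ , x~r₁) , r₁∉Q) ((_ , x~r₂) , r₂∉Q) ((_ , x~r₃) , r₃∉Q)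
                  Qq₁ q₁≢x Qq₂ Qq₃ r₁~q₁ r₂~q₂ r₃~q₃ r₁≁q₂ r₁≁q₃ r₂≁q₃ =
        pair x~r₁ (x~ Qq₁ q₁≢x) r₁~q₁
        (pair ((x~r₂ , r₂≢r₁) , outside r₂∉Q Qq₁) ((x~ Qq₂ q₂≢x , outside r₁∉Q Qq₂ ∘ sym) , q₂≢q₁) r₂~q₂
        (pair ((((x~r₃ , r₃≢r₁) , outside r₃∉Q Qq₁) , r₃≢r₂) , outside r₃∉Q Qq₂)
              ((((x~ Qq₃ q₃≢x , outside r₁∉Q Qq₃ ∘ sym) , q₃≢q₁) , outside r₂∉Q Qq₃ ∘ sym) , q₃≢q₂) r₃~q₃
        (match-⊆ remaining
          (clique-has-match 3 4 (# Q) Q (Q - x - q₁ - q₂ - q₃) clique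
            (≤-trans (≤-reflexive (+-assoc (2 * m) 6 4)) #Q)
            (≤-trans (#-remove² Q x q₁) (+-monoʳ-≤ 2 (#-remove² (Q - x - q₁) q₂ q₃)))
            (proj₁ ∘ proj₁ ∘ proj₁ ∘ proj₁)))))
        where
        outside : ∀ {r q} → ¬ Q ∋ r → Q ∋ q → r ≢ q
        outside r∉Q Qq refl = r∉Q Qq
        x~ : ∀ {q} → Q ∋ q → q ≢ x → x ~ q
        x~ Qq q≢x = clique Qx Qq (q≢x ∘ sym)
        q₂≢x : q₂ ≢ x
        q₂≢x refl = r₁≁q₂ (~-sym x~r₁)
        q₃≢x : q₃ ≢ x
        q₃≢x refl = r₁≁q₃ (~-sym x~r₁)
        q₂≢q₁ : q₂ ≢ q₁
        q₂≢q₁ refl = r₁≁q₂ r₁~q₁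
        q₃≢q₁ : q₃ ≢ q₁
        q₃≢q₁ refl = r₁≁q₃ r₁~q₁
        q₃≢q₂ : q₃ ≢ q₂
        q₃≢q₂ refl = r₂≁q₃ r₂~q₂
        r₂≢r₁ : r₂ ≢ r₁
        r₂≢r₁ refl = r₁≁q₂ r₂~q₂
        r₃≢r₁ : r₃ ≢ r₁
        r₃≢r₁ refl = r₁≁q₃ r₃~q₃
        r₃≢r₂ : r₃ ≢ r₂
        r₃≢r₂ refl = r₂≁q₃ r₃~q₃
        remaining : Q - x - q₁ - q₂ - q₃ ⊆ N x - r₁ - q₁ - r₂ - q₂ - r₃ - q₃
        remaining ((((Qv , v≢x) , v≢q₁) , v≢q₂) , v≢q₃) =
          (((((x~ Qv v≢x , outside r₁∉Q Qv ∘ sym) , v≢q₁) , outside r₂∉Q Qv ∘ sym) , v≢q₂) , outside r₃∉Q Qv ∘ sym) , v≢q₃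

      Edgeless : Subset → Set
      Edgeless P = ∀ {a b} → P ∋ a → P ∋ b → ¬ a ~ b

      -- Five vertices of an edgeless `R x` form a maximum independent set of `S`, so they dominate
      -- `Q`.
      neighbour : ∀ {x q} → Q ∋ x → Edgeless (R x) → Q ∋ q → ∃[ r ] R x ∋ r × r ~ q
      neighbour {x} {q} Qx edgeless Qq = among (elements 5 (R x) (#R Qx))
        where
        among : ∃[ L ] length L ≡ 5 × AllPairs _≢_ L × All (R x ∋_) L → ∃[ r ] R x ∋ r × r ~ q
        among (L , |L| , uniq , L⊆R) = found (find (dominated α (edgeless-independent {R x} edgeless uniq L⊆R) |L|
            (All.map (proj₁ ∘ proj₁) L⊆R) (inside Qq) (All.map (λ { (_ , r∉Q) refl → r∉Q Qq }) L⊆R)))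
          where
          found : ∃[ r ] r ∈ L × r ~ q → ∃[ r ] R x ∋ r × r ~ q
          found (r , r∈L , r~q) = r , All.lookup L⊆R r∈L , r~q

      extend-edges : ∀ {x} P → Q ∋ x → Edgeless (R x) → P ⊆ Q → 0 < # P → ∃[ q ] ∃[ r ] P ∋ q × R x ∋ r × r ~ q
      extend-edges {x} P Qx edgeless P⊆Q 0<P = first (#-positive P 0<P)
        where
        first : ∃[ q ] P ∋ q → ∃[ q ] ∃[ r ] P ∋ q × R x ∋ r × r ~ q
        first (q , Pq) = second (neighbour Qx edgeless (P⊆Q Pq))
          where
          second : ∃[ r ] R x ∋ r × r ~ q → ∃[ q ] ∃[ r ] P ∋ q × R x ∋ r × r ~ q
          second (r , Rr , r~q) = q , r , Pq , Rr , r~q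

      #-∖₁ : ∀ {x r} → R x ∋ r → 0 < # (Q ∖ N r)
      #-∖₁ {r = r} ((Sr , _) , r∉Q) = two-more m (# Q) (# (Q ∩ N r)) (# (Q ∖ N r)) 0 (# (Q ∖ N r)) #Q
        (#-split Q (N r)) (few Sr r∉Q) refl z≤n

      #-∖₂ : ∀ {x r s} → R x ∋ r → R x ∋ s → 0 < # (Q ∖ N r ∖ N s)
      #-∖₂ {r = r} {s} ((Sr , _) , r∉Q) ((Ss , _) , s∉Q) =
        two-more m (# Q) (# (Q ∩ N r)) (# (Q ∖ N r)) (# ((Q ∖ N r) ∩ N s)) (# (Q ∖ N r ∖ N s)) #Q
          (#-split Q (N r)) (few Sr r∉Q) (#-split (Q ∖ N r) (N s))
          (≤-trans (#-mono {(Q ∖ N r) ∩ N s} {Q ∩ N s} λ ((Qy , _) , s~y) → Qy , s~y) (few Ss s∉Q))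

      #-∖₀ : ∀ {x} → Q ∋ x → 0 < # (Q - x)
      #-∖₀ {x} Qx = one-more m (# Q) (# (Q - x)) #Q (#-remove-≤ Q x)

      -- By `few`, each `r` sees at most three vertices of `Q`. Hence `q₂` can be chosen outside
      -- `N r₁`, and `q₃` outside both `N r₁` and `N r₂`, as `three-edges` demands.
      edgeless-absurd : ∀ {x} → Q ∋ x → Edgeless (R x) → ⊥
      edgeless-absurd {x} Qx edgeless = first (extend-edges (Q - x) Qx edgeless proj₁ (#-∖₀ Qx))
        where
        first : ¬ (∃[ q ] ∃[ r ] (Q - x) ∋ q × R x ∋ r × r ~ q)
        first (q₁ , r₁ , (Qq₁ , q₁≢x) , Rr₁ , r₁~q₁) =
            second (extend-edges (Q ∖ N r₁) Qx edgeless proj₁ (#-∖₁ Rr₁))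
          where
          second : ¬ (∃[ q ] ∃[ r ] (Q ∖ N r₁) ∋ q × R x ∋ r × r ~ q)
          second (q₂ , r₂ , (Qq₂ , r₁≁q₂) , Rr₂ , r₂~q₂) =
              third (extend-edges (Q ∖ N r₁ ∖ N r₂) Qx edgeless (proj₁ ∘ proj₁) (#-∖₂ Rr₁ Rr₂))
            where
            third : ¬ (∃[ q ] ∃[ r ] (Q ∖ N r₁ ∖ N r₂) ∋ q × R x ∋ r × r ~ q)
            third (q₃ , r₃ , ((Qq₃ , r₁≁q₃) , r₂≁q₃) , Rr₃ , r₃~q₃) = fan-free x
              (three-edges Qx Rr₁ Rr₂ Rr₃ Qq₁ q₁≢x Qq₂ Qq₃ r₁~q₁ r₂~q₂ r₃~q₃ r₁≁q₂ r₁≁q₃ r₂≁q₃)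

      -- Some edge lies in `R x`, and by `edge-blocks` every non-leaf neighbour of `x` is one of its
      -- ends.
      non-leaves : ∀ {x} → Q ∋ x → ∃[ y₁ ] ∃[ y₂ ] (∀ {y} → NonLeaf x y → y ≡ y₁ ⊎ y ≡ y₂)
      non-leaves {x} Qx with edge? (R x)
      ... | inj₂ edgeless = ⊥-elim (edgeless-absurd Qx edgeless)
      ... | inj₁ (y₁ , y₂ , Ry₁ , Ry₂ , y₁~y₂) = y₁ , y₂ , λ {y} → only {y}
        where
        only : ∀ {y} → NonLeaf x y → y ≡ y₁ ⊎ y ≡ y₂
        only {y} nl with y Fin.≟ y₁ | y Fin.≟ y₂
        ... | yes y≡y₁ | _        = inj₁ y≡y₁
        ... | no _     | yes y≡y₂ = inj₂ y≡y₂
        ... | no y≢y₁  | no y≢y₂  = ⊥-elim (edge-blocks Qx Ry₁ Ry₂ y₁~y₂ nl y≢y₁ y≢y₂)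

      partner : ∀ {x z} → Q ∋ x → NonLeaf x z → ∃[ w ] (∀ {y} → NonLeaf x y → y ≡ z ⊎ y ≡ w)
      partner {x} Qx nl with y₁ , y₂ , only ← non-leaves Qx with only nl
      ... | inj₁ refl = y₂ , only
      ... | inj₂ refl = y₁ , λ {y} nl′ → [ inj₂ , inj₁ ]′ (only {y} nl′)

      -- E holds all non-leaf neighbours of L, so an independent set avoiding E dominates L by leaves.
      avoid : ∀ E L M → length E ≤ 4 → All (Q ∋_) L →
              (∀ {x y} → x ∈ L → NonLeaf x y → y ∈ E) →
              (∀ {z} → S ∋ z → ¬ Q ∋ z → # (Q ∩ N z) ≤ M) →
              (∀ s t → s + t ≡ 5 → # ⟨ L ⟩ˡ ≤ s → # Q ≤ s + M * t → ⊥) → ⊥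
      avoid E L M |E| L⊆Q E-full bound = clique-count 4 (8 * m + 46) S Q (Q ∪ ⟨ E ⟩ˡ) ⟨ L ⟩ˡ M α below inside inj₁
        -- Four extra vertices are the most that can be spared: `10 * m + 61` less `2 * m + 14`
        -- exceeds `8 * m + 46` by one.
        (clique-rest S (Q ∪ ⟨ E ⟩ˡ) (# Q + # ⟨ E ⟩ˡ) (#-∪ Q ⟨ E ⟩ˡ)
          (five-rest m (# S) (# Q) (# ⟨ E ⟩ˡ) large #Q≤ (≤-trans (#-list E) |E|)))
        (λ x∈L → All.lookup L⊆Q x∈L)
        (λ Si i∉ → bound Si (i∉ ∘ inj₁))
        leaf
        where
        leaf : ∀ {i x q} → S ∋ i → ¬ (Q ∪ ⟨ E ⟩ˡ) ∋ i → x ∈ L → i ~ x → Q ∋ q → i ~ q → q ≡ x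
        leaf {i} {x} {q} Si i∉ x∈L i~x Qq i~q = decidable-stable (q Fin.≟ x) λ q≢x →
          i∉ (inj₂ (E-full x∈L (Si , i∉ ∘ inj₁ , i~x , q , Qq , i~q , q≢x)))

      -- A single forced leaf suffices, since 1 + 2 · 4 = 9 < 2ℓ - 2.
      low-degree-absurd : (∀ {z} → S ∋ z → ¬ Q ∋ z → # (Q ∩ N z) ≤ 2) → ⊥
      low-degree-absurd bound = member (#-positive Q (one-more m (# Q) (# Q) #Q (n≤1+n (# Q))))
        where
        member : ¬ (∃[ x ] Q ∋ x)
        member (x , Qx) = blocked (non-leaves Qx)
          where
          blocked : ¬ (∃[ y₁ ] ∃[ y₂ ] (∀ {y} → NonLeaf x y → y ≡ y₁ ⊎ y ≡ y₂))
          blocked (y₁ , y₂ , only) = avoid (y₁ ∷ y₂ ∷ []) (x ∷ []) 2 (s≤s (s≤s z≤n)) (Qx ∷ [])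
            (λ { (here refl) nl → [ here , there ∘ here ]′ (only nl) }) bound
            (λ s t s+t X≤s → single-leaf m (# Q) s t #Q s+t (≤-trans (#-list-≥ (x ∷ []) ([] ∷ [])) X≤s))

      -- The vertex `z` is a common non-leaf neighbour of three vertices of `Q`, each of which has
      -- at most one other. Avoiding these four forces three leaves, and 3 + 3 · 2 = 9 < 2ℓ - 2.
      triple-absurd : ∀ {z} → S ∋ z → ¬ Q ∋ z → 3 ≤ # (Q ∩ N z) → ⊥
      triple-absurd {z} Sz z∉Q 3≤ = listed (elements 3 (Q ∩ N z) 3≤)
        where
        Partner : V → Set
        Partner x = ∃[ w ] (∀ {y} → NonLeaf x y → y ≡ z ⊎ y ≡ w)
        blocked : ∀ {x₁ x₂ x₃} → AllPairs _≢_ (x₁ ∷ x₂ ∷ x₃ ∷ []) → Q ∋ x₁ → Q ∋ x₂ → Q ∋ x₃ →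
                  Partner x₁ → Partner x₂ → Partner x₃ → ⊥
        blocked {x₁} {x₂} {x₃} uniq Qx₁ Qx₂ Qx₃ (w₁ , only₁) (w₂ , only₂) (w₃ , only₃) =
          avoid (z ∷ w₁ ∷ w₂ ∷ w₃ ∷ []) (x₁ ∷ x₂ ∷ x₃ ∷ []) 3 ≤-refl (Qx₁ ∷ Qx₂ ∷ Qx₃ ∷ [])
            (λ { (here refl)                 nl → [ here , there ∘ here ]′ (only₁ nl)
               ; (there (here refl))         nl → [ here , there ∘ there ∘ here ]′ (only₂ nl)
               ; (there (there (here refl))) nl → [ here , there ∘ there ∘ there ∘ here ]′ (only₃ nl) })
            few (λ s t s+t X≤s → three-leaves m (# Q) s t #Q s+t (≤-trans (#-list-≥ _ uniq) X≤s))
        listed : ¬ (∃[ L ] length L ≡ 3 × AllPairs _≢_ L × All ((Q ∩ N z) ∋_) L)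
        listed (x₁ ∷ x₂ ∷ x₃ ∷ [] , refl , uniq@((x₁≢x₂ ∷ _) ∷ (x₂≢x₃ ∷ []) ∷ _) ,
                (Qx₁ , z~x₁) ∷ (Qx₂ , z~x₂) ∷ (Qx₃ , z~x₃) ∷ []) =
          blocked uniq Qx₁ Qx₂ Qx₃
            (partner Qx₁ (Sz , z∉Q , z~x₁ , x₂ , Qx₂ , z~x₂ , x₁≢x₂ ∘ sym))
            (partner Qx₂ (Sz , z∉Q , z~x₂ , x₁ , Qx₁ , z~x₁ , x₁≢x₂))
            (partner Qx₃ (Sz , z∉Q , z~x₃ , x₂ , Qx₂ , z~x₂ , x₂≢x₃))

      absurd : ⊥
      absurd = decide (search (S ∖ Q) (λ z → 3 ≤? # (Q ∩ N z)))
        where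
        decide : (∃[ z ] (S ∖ Q) ∋ z × 3 ≤ # (Q ∩ N z)) ⊎ (∀ {z} → (S ∖ Q) ∋ z → ¬ 3 ≤ # (Q ∩ N z)) → ⊥
        decide (inj₁ (z , (Sz , z∉Q) , 3≤)) = triple-absurd Sz z∉Q 3≤
        decide (inj₂ none) = low-degree-absurd λ Sz z∉Q → ≤-pred (≰⇒> (none (Sz , z∉Q)))

    -- |Q| = 2ℓ − 3: then Q - v has a perfect matching and 7 neighbours of v remain.
    top-even-absurd : ∀ S Q {v} → α≤ 5 S → MaximalClique S Q → 2 * m + 9 ≤ # Q → # Q ≤ 2 * m + 9 →
                      Q ∋ v → Top 5 S v → ⊥
    top-even-absurd S Q {v} α mc #Q #Q≤ Qv top = fan-free v (match-∪ R⊆N Q⊆N disjoint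
      (greedy 2 R α-R (s≤s #R))
      (clique-has-match 4 1 (# Q) Q (Q - v) clique (≤-trans (≤-reflexive (+-assoc (2 * m) 8 1)) #Q)
        (#-remove-≤ Q v) proj₁))
      where
      open MaximalClique mc
      R : Subset
      R = (S ∩ N v) ∖ Q
      R⊆N : R ⊆ N v
      R⊆N ((_ , v~x) , _) = v~x
      Q⊆N : Q - v ⊆ N v
      Q⊆N (Qx , x≢v) = clique Qv Qx (x≢v ∘ sym)
      disjoint : ∀ {x} → R ∋ x → ¬ (Q - v) ∋ x
      disjoint (_ , x∉Q) (Qx , _) = x∉Q Qx
      #R : 7 ≤ # R
      #R = outside-≥7 m (deg S v) (# Q) (# (Q - v)) (# ((S ∩ N v) ∩ Q)) (# R)
        (≤-trans (≤-reflexive (sym (+-assoc (2 * m) 10 5))) top) (#-split (S ∩ N v) Q)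
        (#-mono {(S ∩ N v) ∩ Q} {Q - v} λ ((_ , v~x) , Qx) → Qx , λ { refl → ~⇒≢ v~x refl })
        (≤-reflexive (sym (#-remove Q v Qv))) #Q≤
      -- By `top-leaf` any other vertex of `Q` has no neighbour in `R` and so extends every
      -- independent subset of `R`. With 4 in place of 5, seven vertices are enough for `greedy` to
      -- find two edges.
      α-R : α≤ 4 R
      α-R = other (#-positive (Q - v) (one-more₉ m (# Q) (# (Q - v)) #Q (#-remove-≤ Q v)))
        where
        other : ∃[ q ] (Q - v) ∋ q → α≤ 4 R
        other (q , Qq , q≢v) = bounded λ L ind L⊆ → ≤-pred (independent-≤ α (q ∷ L)
          (All.map (λ ((Sr , v~r) , r∉Q) → (λ { refl → r∉Q Qq }) ,
            λ q~r → q≢v (top-leaf α mc Qv top Sr r∉Q (~-sym v~r) Qq (~-sym q~r))) L⊆ ∷ ind)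
          (inside Qq ∷ All.map (proj₁ ∘ proj₁) L⊆))

    -- The sharper bounds in the absence of cliques of order 2ℓ - 1.

    cliques-≤ : ∀ b S → Small S → (∀ Q → MaximalClique S Q → b < # Q → ⊥) → ∀ C → C ⊆ S → Clique C → # C ≤ b
    cliques-≤ b S small none C C⊆S cl = ≮⇒≥ λ big →
      let Q , C⊆Q , mc = maximal-clique C small C⊆S cl in none Q mc (<-≤-trans big (#-mono {C} {Q} C⊆Q))

    Bound : ℕ → ℕ → Set₁
    Bound k B = ∀ P → Small P → α≤ k P → # P ≤ B

    below : ∀ k B S → Bound k B → Small S → Below k B S
    below k B S bound small P P⊆S = bound P (λ C C⊆P → small C (P⊆S ∘ C⊆P))

    bound₀ : Bound 0 0
    bound₀ P _ = α₀-empty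

    bound₁ : Bound 1 (2 * m + 10)
    bound₁ P small α = small P id (α₁-clique α)

    -- The non-neighbours of a vertex form a clique. Large cliques are excluded because two vertices
    -- with at most four neighbours each cannot dominate them; this makes every vertex top. Then
    -- `all-top` leaves at most two non-neighbours, which is too few for the order of `S`.
    bound₂ : Bound 2 (4 * m + 20)
    bound₂ S small α = ≮⇒≥ contradict
      where
      below₁ : Below 1 (2 * m + 10) S
      below₁ = below 1 (2 * m + 10) S bound₁ small
      contradict : 4 * m + 20 < # S → ⊥
      contradict large = two-clique m (# S) (deg S v) (# (S ∖ N[ v ])) (# Q) large (#-degree S v) (deg-≤ S v α)
          (#-mono {S ∖ N[ v ]} {Q} C⊆Q) (all-top 1 (2 * m + 10) S Q α below₁ mc (rest Q mc) top)
        where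
        rest : ∀ Q → MaximalClique S Q → 2 * m + 10 < # (S ∖ Q)
        rest Q mc = clique-rest S Q (2 * m + 10) (small Q inside clique) (two-rest m (# S) large)
          where open MaximalClique mc
        no-large : ∀ Q → MaximalClique S Q → 2 * m + 8 < # Q → ⊥
        no-large Q mc big = clique-count 1 (2 * m + 10) S Q Q ⟨ [] ⟩ˡ 4 α below₁ inside id (rest Q mc) (λ ())
          (outside-degree 0 4 0 (2 * m + 10) S Q α (below 0 0 S bound₀ small) below₁ mc (two-codegree m (# S) large)
            (seven≤ m (# Q) big) (rest Q mc))
          (λ _ _ ()) (λ s t s+t _ → two-count m (# Q) s t big s+t)
          where open MaximalClique mc
        non-neighbours : ∀ {v} → S ∋ v → Clique (S ∖ N[ v ])
        non-neighbours Sv = α₁-clique (α-∖N Sv α)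
        top : ∀ {v} → S ∋ v → Top 2 S v
        top {v} Sv = two-degree m (# S) (deg S v) _ large (#-degree S v)
          (cliques-≤ (2 * m + 8) S small no-large (S ∖ N[ v ]) proj₁ (non-neighbours Sv))
        v∈S : ∃[ v ] S ∋ v
        v∈S = #-positive S (≤-trans (s≤s z≤n) large)
        v : V
        v = proj₁ v∈S
        extension : Σ Subset λ Q → (S ∖ N[ v ]) ⊆ Q × MaximalClique S Q
        extension = maximal-clique (S ∖ N[ v ]) small proj₁ (non-neighbours (proj₂ v∈S))
        Q : Subset
        Q = proj₁ extension
        C⊆Q : (S ∖ N[ v ]) ⊆ Q
        C⊆Q = proj₁ (proj₂ extension)
        mc : MaximalClique S Q
        mc = proj₂ (proj₂ extension)

    -- The bound for independence number 2 already makes every vertex top, so all cliques have at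
    -- most three vertices and private cliques are tiny.
    bound₃ : Bound 3 (6 * m + 33)
    bound₃ S small α = ≮⇒≥ λ large →
      let top : ∀ {v} → S ∋ v → Top 3 S v
          top = min-degree 2 (4 * m + 20) S (2 * m + 10 + 3) α below₂ (three-degree m (# S) large)
          no-large : ∀ Q → MaximalClique S Q → 3 < # Q → ⊥
          no-large Q mc big = <⇒≱ big (all-top 2 (4 * m + 20) S Q α below₂ mc
            (clique-rest S Q (2 * m + 10) (small Q (MaximalClique.inside mc) (MaximalClique.clique mc))
              (three-rest m (# S) large)) top)
      in few-private 2 (4 * m + 20) S (2 * m + 17) α below₂ (three-whole m (# S) large)
           (λ v C _ _ C⊆S cl → three-bound m (# C) (deg S v) (cliques-≤ 3 S small no-large C C⊆S cl) (deg-≤ S v α))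
           (three-private m (# S) large)
      where
      below₂ : Below 2 (4 * m + 20) S
      below₂ = below 2 (4 * m + 20) S bound₂ small

    -- Four vertices with at most two neighbours each do not dominate a clique of order 2ℓ - 3. For
    -- smaller cliques the private count is just enough: 4(4m + 23) < 2(8m + 47).
    bound₄ : Bound 4 (8 * m + 46)
    bound₄ S small α = ≮⇒≥ λ large →
      few-private 3 (6 * m + 33) S (4 * m + 23) α below₃ (four-whole m (# S) large)
        (λ v C _ _ C⊆S cl → four-bound m (# C) (deg S v)
          (cliques-≤ (2 * m + 8) S small (no-large large) C C⊆S cl) (deg-≤ S v α))
        (four-private m (# S) large)
      where
      below₃ : Below 3 (6 * m + 33) S
      below₃ = below 3 (6 * m + 33) S bound₃ small
      no-large : 8 * m + 46 < # S → ∀ Q → MaximalClique S Q → 2 * m + 8 < # Q → ⊥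
      no-large large Q mc big = clique-count 3 (6 * m + 33) S Q Q ⟨ [] ⟩ˡ 2 α below₃ inside id rest (λ ())
        (outside-degree 2 2 (4 * m + 20) (6 * m + 33) S Q α (below 2 (4 * m + 20) S bound₂ small) below₃ mc
          (four-codegree m (# S) large) (seven≤ m (# Q) big) rest)
        (λ _ _ ()) (λ s t s+t _ → four-count m (# Q) s t big s+t)
        where
        open MaximalClique mc
        rest : 6 * m + 33 < # (S ∖ Q)
        rest = clique-rest S Q (2 * m + 10) (small Q inside clique) (four-rest m (# S) large)

    bound₅ : Bound 5 (10 * m + 60)
    bound₅ S small α = ≮⇒≥ λ large →
      few-private 4 (8 * m + 46) S (4 * m + 24) α below₄ (five-whole m (# S) large) (weight large)
        (five-private m (# S) large)
      where
      below₄ : Below 4 (8 * m + 46) S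
      below₄ = below 4 (8 * m + 46) S bound₄ small
      -- Five vertices with three neighbours each could cover 15 vertices, too many for a plain
      -- count when ℓ is small; hence the analysis in `ExtremalClique`.
      no-large : 10 * m + 60 < # S → ∀ Q → MaximalClique S Q → 2 * m + 9 < # Q → ⊥
      no-large large Q mc big = ExtremalClique.absurd S Q α below₄ mc (five-large m (# S) large)
        (above 9 m (# Q) (# Q) big ≤-refl) (small Q inside clique)
        (outside-degree 3 3 (6 * m + 33) (8 * m + 46) S Q α (below 3 (6 * m + 33) S bound₃ small) below₄ mc
          (five-codegree m (# S) large) (nine≤ m (# Q) big)
          (clique-rest S Q (2 * m + 10) (small Q inside clique) (five-rest₀ m (# S) large)))
        where open MaximalClique mc
      -- The largest clique order 2ℓ - 3 and the largest degree 2ℓ + 3 would together exceed the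
      -- bound by one; `top-even-absurd` shows that they do not occur together. The count needs 5(4m
      -- + 24) < 2(10m + 61).
      weight : 10 * m + 60 < # S → ∀ v C → S ∋ v → C ∋ v → C ⊆ S → Clique C → # C + suc (deg S v) ≤ 4 * m + 24
      weight large v C Sv Cv C⊆S cl = cases (# C ≤? 2 * m + 8) (2 * m + 10 + 5 ≤? deg S v)
        where
        not-both : 2 * m + 8 < # C → Top 5 S v →
                   (Σ Subset λ Q → C ⊆ Q × MaximalClique S Q) → # C + suc (deg S v) ≤ 4 * m + 24
        not-both big top (Q , C⊆Q , mc) = ⊥-elim (top-even-absurd S Q α mc
          (above 8 m (# C) (# Q) big (#-mono {C} {Q} C⊆Q))
          (cliques-≤ (2 * m + 9) S small (no-large large) Q (MaximalClique.inside mc) (MaximalClique.clique mc))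
          (C⊆Q Cv) top)
        cases : Dec (# C ≤ 2 * m + 8) → Dec (Top 5 S v) → # C + suc (deg S v) ≤ 4 * m + 24
        cases (yes low)  _         = five-bound-small m (# C) (deg S v) low (deg-≤ S v α)
        cases (no _)     (no ¬top) = five-bound-low m (# C) (deg S v)
          (cliques-≤ (2 * m + 9) S small (no-large large) C C⊆S cl) (≰⇒> ¬top)
        cases (no high)  (yes top) = not-both (≰⇒> high) top (maximal-clique C small C⊆S cl)

    -- The induction hypothesis serves only to exclude cliques of order 2ℓ - 1; after that the
    -- sharper bounds apply, none of which exceeds 2ℓk.
    upper : ∀ k → k ≤ 5 → ∀ S → α≤ k S → # S ≤ (2 * m + 12) * k
    upper zero    _   S α = ≤-trans (α₀-empty α) z≤n
    upper (suc k) k<5 S α = ≮⇒≥ λ large → conclude k k<5 α large λ C C⊆S cl → ≮⇒≥ λ big →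
      exclusion k S C k<5 α (λ P _ → upper k (≤-trans (n≤1+n k) k<5) P) large C⊆S cl (above 10 m (# C) (# C) big ≤-refl)
      where
      conclude : ∀ k → suc k ≤ 5 → α≤ (suc k) S → (2 * m + 12) * suc k < # S → Small S → ⊥
      conclude 0 _ α large small = upper₁ m (# S) large (bound₁ S small α)
      conclude 1 _ α large small = upper₂ m (# S) large (bound₂ S small α)
      conclude 2 _ α large small = upper₃ m (# S) large (bound₃ S small α)
      conclude 3 _ α large small = upper₄ m (# S) large (bound₄ S small α)
      conclude 4 _ α large small = upper₅ m (# S) large (bound₅ S small α)
      conclude (suc (suc (suc (suc (suc _))))) (s≤s (s≤s (s≤s (s≤s (s≤s ()))))) _ _ _

-- From matchings and independent lists to subgraphs.

sum-one : ∀ n → sum {n} (λ _ → 1) ≡ n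
sum-one zero    = refl
sum-one (suc n) = cong suc (sum-one n)

module _ {n : ℕ} (G : Graph (Fin n)) where

  open Subsets n
  open Graphs G

  -- Together with `independent?`, this finite search makes the choice in `Arrows` constructive.
  match? : ∀ m P → Dec (Match P m)
  match? zero    P = yes ∅
  match? (suc m) P = map′ (λ (a , b , Pa , Pb , a~b , M) → pair Pa Pb a~b M)
    (λ { (pair Pa Pb a~b M) → _ , _ , Pa , Pb , a~b , M })
    (Fin.any? λ a → Fin.any? λ b → mem? P a ×-dec mem? P b ×-dec (a ~? b) ×-dec match? m (P - a - b))

  independent? : ∀ k P → Dec (∃[ L ] Independent L × length L ≡ k × All (P ∋_) L)
  independent? zero    P = yes ([] , [] , refl , [])
  independent? (suc k) P = map′
    (λ (x , Px , L , ind , |L| , L⊆) → x ∷ L ,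
      All.map (λ (_ , y∉) → (λ x≡y → y∉ (inj₁ (sym x≡y))) , y∉ ∘ inj₂) L⊆ ∷ ind ,
      cong suc |L| , Px ∷ All.map proj₁ L⊆)
    (λ { (x ∷ L , x-apart ∷ ind , |L| , Px ∷ L⊆) → x , Px , L , ind , suc-injective |L| ,
      All.zipWith (λ ((x≢y , x≁y) , Py) → Py , [ x≢y ∘ sym , x≁y ]′) (x-apart , L⊆) })
    (Fin.any? λ x → mem? P x ×-dec independent? k (P ∖ N[ x ]))

  end : ∀ {P m} → Match P m → Fin m → Fin 2 → V
  end (pair {a = a} _ _ _ _) zero    zero       = a
  end (pair {b = b} _ _ _ _) zero    (suc zero) = b
  end (pair _ _ _ M)         (suc i) u          = end M i u

  end-∈ : ∀ {P m} (M : Match P m) i u → P ∋ end M i u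
  end-∈ (pair Pa _ _ _) zero    zero       = Pa
  end-∈ (pair _ Pb _ _) zero    (suc zero) = Pb
  end-∈ (pair _ _ _ M)  (suc i) u          = proj₁ (proj₁ (end-∈ M i u))

  end-~ : ∀ {P m} (M : Match P m) i {u v} → u ≢ v → end M i u ~ end M i v
  end-~ (pair _ _ a~b _) zero {zero}     {zero}     u≢v = ⊥-elim (u≢v refl)
  end-~ (pair _ _ a~b _) zero {zero}     {suc zero} u≢v = a~b
  end-~ (pair _ _ a~b _) zero {suc zero} {zero}     u≢v = ~-sym a~b
  end-~ (pair _ _ a~b _) zero {suc zero} {suc zero} u≢v = ⊥-elim (u≢v refl)
  end-~ (pair _ _ _ M)   (suc i) u≢v = end-~ M i u≢v

  end-injective : ∀ {P m} (M : Match P m) i j {u v} → end M i u ≡ end M j v → (i , u) ≡ (j , v)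
  end-injective (pair _ _ a~b _) zero zero {zero}     {zero}     _   = refl
  end-injective (pair _ _ a~b _) zero zero {zero}     {suc zero} a≡b = ⊥-elim (~⇒≢ a~b a≡b)
  end-injective (pair _ _ a~b _) zero zero {suc zero} {zero}     b≡a = ⊥-elim (~⇒≢ a~b (sym b≡a))
  end-injective (pair _ _ a~b _) zero zero {suc zero} {suc zero} _   = refl
  end-injective (pair _ _ _ M) zero (suc j) {zero}     {v} eq = ⊥-elim (proj₂ (proj₁ (end-∈ M j v)) (sym eq))
  end-injective (pair _ _ _ M) zero (suc j) {suc zero} {v} eq = ⊥-elim (proj₂ (end-∈ M j v) (sym eq))
  end-injective (pair _ _ _ M) (suc i) zero {u} {zero}     eq = ⊥-elim (proj₂ (proj₁ (end-∈ M i u)) eq)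
  end-injective (pair _ _ _ M) (suc i) zero {u} {suc zero} eq = ⊥-elim (proj₂ (end-∈ M i u) eq)
  end-injective (pair _ _ _ M) (suc i) (suc j) eq with refl ← end-injective M i j eq = refl

  contains-fan : ∀ {ℓ} v → Match (N v) ℓ → G Contains fan ℓ
  contains-fan {ℓ} v M = f , injective _ _ , adjacent
    where
    f : Fin 1 ⊎ (Fin ℓ × Fin 2) → V
    f (inj₁ _)       = v
    f (inj₂ (i , u)) = end M i u
    injective : ∀ x y → f x ≡ f y → x ≡ y
    injective (inj₁ zero)    (inj₁ zero)    _  = refl
    injective (inj₁ _)       (inj₂ (i , u)) eq = ⊥-elim (~⇒≢ (end-∈ M i u) eq)
    injective (inj₂ (i , u)) (inj₁ _)       eq = ⊥-elim (~⇒≢ (end-∈ M i u) (sym eq))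
    injective (inj₂ (i , u)) (inj₂ (j , w)) eq = cong inj₂ (end-injective M i j eq)
    adjacent : ∀ x y → Adj (fan ℓ) x y → f x ~ f y
    adjacent (inj₁ zero)    (inj₁ zero)    0≢0          = ⊥-elim (0≢0 refl)
    adjacent (inj₁ _)       (inj₂ (i , u)) _            = end-∈ M i u
    adjacent (inj₂ (i , u)) (inj₁ _)       _            = ~-sym (end-∈ M i u)
    adjacent (inj₂ (i , u)) (inj₂ (j , w)) (refl , u≢w) = end-~ M i u≢w

  lookup-apart : ∀ {L} → Independent L → ∀ i j → i ≢ j → Apart (lookup L i) (lookup L j)
  lookup-apart (_ ∷ _)         zero    zero    i≢j = ⊥-elim (i≢j refl)
  lookup-apart (x-apart ∷ _)   zero    (suc j) i≢j = All.lookup x-apart (∈-lookup j)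
  lookup-apart (x-apart ∷ _)   (suc i) zero    i≢j = apart-sym (All.lookup x-apart (∈-lookup i))
  lookup-apart (_ ∷ ind)       (suc i) (suc j) i≢j = lookup-apart ind i j (i≢j ∘ cong suc)

  complement-contains : ∀ {L} → Independent L → complement Fin._≟_ G Contains complete (length L)
  complement-contains {L} ind = lookup L ,
    (λ {i} {j} eq → decidable-stable (i Fin.≟ j) λ i≢j → proj₁ (lookup-apart ind i j i≢j) eq) ,
    lookup-apart ind

  arrows : ∀ m → (2 * m + 12) * 5 < n → G Contains fan (6 + m) ⊎ complement Fin._≟_ G Contains complete 6
  arrows m large with Fin.any? (λ v → match? (6 + m) (N v))
  ... | yes (v , M) = inj₁ (contains-fan v M)
  ... | no fan-free with independent? 6 full
  ...   | yes (L , ind , |L| , _) = inj₂ (subst (λ k → complement Fin._≟_ G Contains complete k) |L| (complement-contains ind))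
  ...   | no none = ⊥-elim (independent-set 5 full _ (FanFree.upper G m (λ v M → fan-free (v , M)) 5 ≤-refl full)
      (subst (_ <_) (sym (sum-one n)) large) (λ I ind |I| I⊆ → none (I , ind , |I| , I⊆)))

-- The lower bound construction.

residue : ∀ {s} → Fin s → Fin 5
residue u = toℕ u mod 5

-- Given for every order `s`, since minimality requires a counterexample at each order up to 10ℓ.
residue-graph : ∀ s → Graph (Fin s)
residue-graph s = record
  { Adj    = λ u v → u ≢ v × residue u ≡ residue v
  ; symm   = λ (u≢v , u≡v) → u≢v ∘ sym , sym u≡v
  ; irrefl = λ u≡v (u≢v , _) → u≢v u≡v
  ; adj?   = λ u v → ¬? (u Fin.≟ v) ×-dec (residue u Fin.≟ residue v)
  }

residue-no-K₆ : ∀ s → ¬ complement Fin._≟_ (residue-graph s) Contains complete 6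
residue-no-K₆ s (f , _ , adj) with i , j , i<j , eq ← Fin.pigeonhole ≤-refl (residue ∘ f)
  with fi≢fj , ¬adj ← adj i j (Fin.<⇒≢ i<j) = ¬adj (fi≢fj , eq)

-- All 2ℓ + 1 vertices of a fan share the residue of its centre, while their quotients by 5 take at
-- most 2ℓ values; two vertices then agree in both.
residue-no-fan : ∀ ℓ s → s ≤ ℓ * 2 * 5 → ¬ residue-graph s Contains fan ℓ
residue-no-fan ℓ s s≤ (f , inj , adj) = collide (Fin.pigeonhole ≤-refl quotient)
  where
  open ≡-Reasoning
  h : Fin (suc (ℓ * 2)) → Fin 1 ⊎ (Fin ℓ × Fin 2)
  h zero    = inj₁ zero
  h (suc k) = inj₂ (Fin.remQuot 2 k)
  h-injective : ∀ i j → h i ≡ h j → i ≡ j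
  h-injective zero    zero    _  = refl
  h-injective (suc i) (suc j) eq = cong suc (trans (sym (Fin.combine-remQuot {ℓ} 2 i))
    (trans (cong (λ { (inj₁ _) → i ; (inj₂ (k , u)) → Fin.combine k u }) eq) (Fin.combine-remQuot {ℓ} 2 j)))
  quotient< : ∀ i → toℕ (f (h i)) / 5 < ℓ * 2
  quotient< i = m<n*o⇒m/o<n (<-≤-trans (Fin.toℕ<n (f (h i))) s≤)
  quotient : Fin (suc (ℓ * 2)) → Fin (ℓ * 2)
  quotient i = Fin.fromℕ< (quotient< i)
  same-quotient : ∀ i j → quotient i ≡ quotient j → toℕ (f (h i)) / 5 ≡ toℕ (f (h j)) / 5
  same-quotient i j eq = Fin.fromℕ<-injective _ _ (quotient< i) (quotient< j) eq
  centre : ∀ i → residue (f (h zero)) ≡ residue (f (h i))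
  centre zero    = refl
  centre (suc k) = proj₂ (adj (inj₁ zero) (inj₂ (Fin.remQuot 2 k)) tt)
  same-residue : ∀ i j → toℕ (f (h i)) % 5 ≡ toℕ (f (h j)) % 5
  same-residue i j = Fin.fromℕ<-injective _ _ (m%n<n (toℕ (f (h i))) 5) (m%n<n (toℕ (f (h j))) 5)
    (trans (sym (centre i)) (centre j))
  collide : ¬ (∃[ i ] ∃[ j ] i Fin.< j × quotient i ≡ quotient j)
  collide (i , j , i<j , eq) = Fin.<⇒≢ i<j (h-injective i j (inj (Fin.toℕ-injective (begin
    toℕ (f (h i))                              ≡⟨ m≡m%n+[m/n]*n _ 5 ⟩
    toℕ (f (h i)) % 5 + toℕ (f (h i)) / 5 * 5  ≡⟨ cong₂ (λ r q → r + q * 5) (same-residue i j) (same-quotient i j eq) ⟩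
    toℕ (f (h j)) % 5 + toℕ (f (h j)) / 5 * 5  ≡⟨ m≡m%n+[m/n]*n _ 5 ⟨
    toℕ (f (h j))                              ∎))))

theorem1 : ∀ (ℓ : ℕ) → ℓ ≥ 6 → IsRamseyNumber (fan ℓ) (complete 6) (10 * ℓ + 1)
theorem1 ℓ ℓ≥6 with m , refl ← m≤n⇒∃[o]m+o≡n ℓ≥6 =
  ≤-trans (s≤s z≤n) (m≤n+m 1 (10 * ℓ)) ,
  (λ G → arrows G m (order-large m)) ,
  λ s _ arrow → ≮⇒≥ λ s< → [ residue-no-fan (6 + m) s (order-small m s s<) , residue-no-K₆ s ]′ (arrow (residue-graph s))
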